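{- Let $p$ be a prime and let $R$ be a NIP $\mathbb{F}_p$-algebra. Then $R$ is (isomorphic to) a finite product of Henselian local rings.
   Context: All rings are commutative and unital. A ring is NIP if its complete theory in the language of rings is NIP. -}

module Defs where

open import Level using (Level; _⊔_; Lift)
open import Algebra.Bundles using (CommutativeRing)
open import Data.Nat using (ℕ; zero; suc) renaming (_+_ to _+ℕ_)
open import Data.Fin using (Fin)
open import Data.Bool using (Bool; true)
open import Data.List using (List; []; _∷_; _∷ʳ_)
open import Data.Product using (Σ; _×_; _,_; ∃)
open import Data.Sum using (_⊎_)
open import Data.Empty using (⊥)
open import Relation.Nullary using (¬_)
open import Relation.Binary.PropositionalEquality using (_≡_)
open import Function.Bundles using (_⇔_)
import Data.Vec.Functional as VF

data Term (n : ℕ) : Set where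
  var  : Fin n → Term n
  zer  : Term n
  one  : Term n
  _⊕_  : Term n → Term n → Term n
  _⊗_  : Term n → Term n → Term n
  neg  : Term n → Term n

data Formula : ℕ → Set where
  _≐_  : ∀ {n} → Term n → Term n → Formula n
  ∼_   : ∀ {n} → Formula n → Formula n
  _∧_  : ∀ {n} → Formula n → Formula n → Formula n
  _∨_  : ∀ {n} → Formula n → Formula n → Formula n
  all  : ∀ {n} → Formula (suc n) → Formula n
  ex   : ∀ {n} → Formula (suc n) → Formula n

module _ {c ℓ : Level} (R : CommutativeRing c ℓ) where
  open CommutativeRing R

  ⟦_⟧ₜ : ∀ {n} → Term n → (Fin n → Carrier) → Carrier
  ⟦ var i ⟧ₜ ρ = ρ i
  ⟦ zer ⟧ₜ ρ = 0#
  ⟦ one ⟧ₜ ρ = 1#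
  ⟦ s ⊕ t ⟧ₜ ρ = ⟦ s ⟧ₜ ρ + ⟦ t ⟧ₜ ρ
  ⟦ s ⊗ t ⟧ₜ ρ = ⟦ s ⟧ₜ ρ * ⟦ t ⟧ₜ ρ
  ⟦ neg t ⟧ₜ ρ = - ⟦ t ⟧ₜ ρ

  Sat : ∀ {n} → Formula n → (Fin n → Carrier) → Set (c ⊔ ℓ)
  Sat (s ≐ t) ρ = Lift c (⟦ s ⟧ₜ ρ ≈ ⟦ t ⟧ₜ ρ)
  Sat (∼ φ) ρ = ¬ Sat φ ρ
  Sat (φ ∧ ψ) ρ = Sat φ ρ × Sat ψ ρ
  Sat (φ ∨ ψ) ρ = Sat φ ρ ⊎ Sat ψ ρ
  Sat (all φ) ρ = (a : Carrier) → Sat φ (a VF.∷ ρ)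
  Sat (ex φ) ρ = Σ Carrier (λ a → Sat φ (a VF.∷ ρ))

  Shatters : ∀ k m → Formula (k +ℕ m) → ℕ → Set (c ⊔ ℓ)
  Shatters k m φ N =
    Σ (Fin N → Fin k → Carrier) λ a →
    Σ ((Fin N → Bool) → Fin m → Carrier) λ b →
      ∀ (i : Fin N) (J : Fin N → Bool) → Sat φ (a i VF.++ b J) ⇔ (J i ≡ true)

  -- φ has the independence property (in Th(R)): it shatters arbitrarily
  -- large finite sets (by compactness, equivalent to IP in the monster model)
  HasIP : ∀ k m → Formula (k +ℕ m) → Set (c ⊔ ℓ)
  HasIP k m φ = ∀ N → Shatters k m φ N

  NIP : Set (c ⊔ ℓ)
  NIP = ∀ k m (φ : Formula (k +ℕ m)) → ¬ HasIP k m φ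

  _·ₙ_ : ℕ → Carrier → Carrier
  zero ·ₙ x = 0#
  suc n ·ₙ x = x + (n ·ₙ x)

  -- R is an F_p-algebra, i.e. p = 0 in R (the F_p-algebra structure on a
  -- ring is then unique)
  IsFpAlgebra : ℕ → Set ℓ
  IsFpAlgebra p = (p ·ₙ 1#) ≈ 0#

  record IsIdeal (I : Carrier → Set (c ⊔ ℓ)) : Set (c ⊔ ℓ) where
    field
      resp  : ∀ {x y} → x ≈ y → I x → I y
      zero∈ : I 0#
      +-closed : ∀ {x y} → I x → I y → I (x + y)
      *-closed : ∀ r {x} → I x → I (r * x)

  IsMaximalIdeal : (Carrier → Set (c ⊔ ℓ)) → Set (Level.suc (c ⊔ ℓ))
  IsMaximalIdeal I =
    IsIdeal I × ¬ I 1# ×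
    (∀ (J : Carrier → Set (c ⊔ ℓ)) → IsIdeal J → (∀ x → I x → J x) →
       (∀ x → J x → I x) ⊎ J 1#)

  IsUnit : Carrier → Set (c ⊔ ℓ)
  IsUnit x = Σ Carrier λ y → x * y ≈ 1#

  -- polynomials as coefficient lists a₀ ∷ a₁ ∷ … (lowest degree first)
  eval : List Carrier → Carrier → Carrier
  eval [] x = 0#
  eval (a ∷ as) x = a + x * eval as x

  deriv : List Carrier → List Carrier
  deriv [] = []
  deriv (_ ∷ as) = go 1 as
    where
    go : ℕ → List Carrier → List Carrier
    go k [] = []
    go k (b ∷ bs) = (k ·ₙ b) ∷ go (suc k) bs

  monic : List Carrier → List Carrier
  monic as = as ∷ʳ 1#

  record IsHenselianLocal : Set (Level.suc (c ⊔ ℓ)) where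
    field
      𝔪 : Carrier → Set (c ⊔ ℓ)
      𝔪-maximal : IsMaximalIdeal 𝔪
      𝔪-unique  : ∀ (M : Carrier → Set (c ⊔ ℓ)) → IsMaximalIdeal M →
                    ∀ x → (M x → 𝔪 x) × (𝔪 x → M x)
      hensel : ∀ (as : List Carrier) (a : Carrier) →
                 𝔪 (eval (monic as) a) → ¬ 𝔪 (eval (deriv (monic as)) a) →
                 Σ Carrier λ b → (eval (monic as) b ≈ 0#) × 𝔪 (b - a)

record IsoToProduct {c ℓ : Level} (R : CommutativeRing c ℓ) (n : ℕ)
       (S : Fin n → CommutativeRing c ℓ) : Set (c ⊔ ℓ) where
  module R = CommutativeRing R
  module S (i : Fin n) = CommutativeRing (S i)
  Π : Set c
  Π = (i : Fin n) → S.Carrier i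
  _≈Π_ : Π → Π → Set ℓ
  u ≈Π v = ∀ i → S._≈_ i (u i) (v i)
  field
    to   : R.Carrier → Π
    from : Π → R.Carrier
    to-cong   : ∀ {x y} → x R.≈ y → to x ≈Π to y
    from-cong : ∀ {u v} → u ≈Π v → from u R.≈ from v
    to-from   : ∀ u → to (from u) ≈Π u
    from-to   : ∀ x → from (to x) R.≈ x
    to-+ : ∀ x y i → S._≈_ i (to (x R.+ y) i) (S._+_ i (to x i) (to y i))
    to-* : ∀ x y i → S._≈_ i (to (x R.* y) i) (S._*_ i (to x i) (to y i))
    to-1 : ∀ i → S._≈_ i (to R.1# i) (S.1# i)

{-# OPTIONS --safe #-}
-- Let J be the Jacobson radical of the NIP 𝔽ₚ-algebra R.  The heart of the matter is that (R, J) is a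
-- Henselian pair: for monic f with f(b) ∈ J and f′(b) a unit there is a root in b + J.
--
-- Let f = f(b) + (x - b) g.  In S = R[x]/(f), e = g/f′(b) is idempotent modulo JS.  If t = eᵖ - e ∈ JS has the
-- form sᵖ - s with s ∈ JS, then c = e - s satisfies cᵖ = c, so ε = cᵖ⁻¹ is an idempotent of S congruent to e.
-- By Nakayama (x - b)ε = βε with β ∈ J, and b + β is a root of f.
--
-- The Artin–Schreier equation is solved as by Kaplan, Scanlon and Wagner for fields.  Put H = { sᵖ - s : s ∈ tS }
-- and, for δ ∈ S, consider the definable subgroup { τ : δτ ∈ H }.  For finitely many u₀, …, uₙ and τᵢ built from
-- the uⱼ with j ≠ i, the product uⱼ^(pⁿ) τᵢ lies in H for j ≠ i, and for j = i it is congruent modulo H to a given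
-- multiple of the product of uᵢ - v over the 𝔽ₚ-span of the other u's.  For uⱼ = tʲ that product is a unit times
-- a power of t, so τᵢ can be chosen with uᵢ^(pⁿ) τᵢ congruent to a power t^(pᵏ), hence to t.  If t ∉ H, these
-- subgroups are independent and S, which is interpretable in R, has the independence property.
--
-- Pairwise comaximal nonunits are shattered by comaximality, so there are boundedly many.  A maximal family with
-- at least two members yields an idempotent modulo J that is nontrivial; it lifts to R, and splitting off
-- factors eR terminates, with local factors that inherit NIP.
module Submission where

open import Defs
open import Level using (Level; _⊔_; Lift; lift; lower)
open import Algebra.Bundles using (CommutativeRing)
open import Axiom.ExcludedMiddle using (ExcludedMiddle)
open import Data.Bool using (Bool; true; false; if_then_else_)
open import Data.Fin as Fin using (Fin; zero; suc; toℕ; fromℕ; inject₁; punchIn; punchOut; splitAt; _↑ˡ_; _↑ʳ_)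
import Data.Fin.Properties as Fin
open import Data.Integer as ℤ using (ℤ; +_; -[1+_])
import Data.Integer.Properties as ℤ
open import Data.List as List using (List; []; _∷_; _∷ʳ_; length; tabulate; lookup; foldr)
open import Data.List.Membership.Propositional.Properties using (∈-lookup)
open import Data.List.Properties using (length-++; length-tabulate)
open import Data.List.Relation.Unary.All as All using (All; []; _∷_)
import Data.List.Relation.Unary.All.Properties as All
open import Data.List.Relation.Unary.AllPairs using (AllPairs; []; _∷_)
import Data.List.Relation.Unary.AllPairs.Properties as AllPairs
open import Data.Maybe using (Maybe; just; nothing)
open import Data.Nat as ℕ using (ℕ; zero; suc)
open import Data.Nat.Combinatorics using (_C_; nCn≡1; nCk≡n!/k![n-k]!; k![n∸k]!∣n!)
open import Data.Nat.Divisibility using (_∣_; divides; ∣⇒≤; m∣m*n)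
import Data.Nat.DivMod as ℕ
open import Data.Nat.Primality using (Prime; euclidsLemma; prime⇒nonTrivial)
import Data.Nat.Properties as ℕ
open import Data.Product using (Σ; _×_; _,_; proj₁; proj₂)
open import Data.Sum using (_⊎_; inj₁; inj₂; [_,_])
import Data.Vec.Functional as VF
open import Data.Vec.Functional.Properties using (lookup-++ˡ; lookup-++ʳ)
open import Function using (_∘_; mk⇔; Equivalence)
open import Relation.Binary using (tri<; tri≈; tri>)
open import Relation.Binary.PropositionalEquality as ≡ using (_≡_; _≢_)
open import Relation.Nullary using (¬_; yes; no; contradiction)
import Algebra.Properties.AbelianGroup
import Algebra.Properties.CommutativeSemiring.Binomial
import Algebra.Properties.CommutativeSemiring.Exp
import Algebra.Properties.Monoid.Sum
import Algebra.Properties.Ring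
import Algebra.Properties.Semiring.Mult
import Algebra.Properties.Semiring.Mult.TCOptimised
import Algebra.Properties.Semiring.Sum
import Algebra.Solver.Ring
import Algebra.Solver.Ring.AlmostCommutativeRing as ACR
import Relation.Binary.Reasoning.Setoid

-- Ring solver with integer coefficients

module IntegerSolver {c ℓ : Level} (R : CommutativeRing c ℓ) where
  open CommutativeRing R
  open Algebra.Properties.Ring ring
  open Algebra.Properties.AbelianGroup +-abelianGroup using (⁻¹-∙-comm)
  open Algebra.Properties.Semiring.Mult.TCOptimised semiring using (×-homo-+; ×1-homo-*; 1+×) renaming (_×_ to _·_)
  open Relation.Binary.Reasoning.Setoid setoid

  ⟦_⟧ℤ : ℤ → Carrier
  ⟦ + n ⟧ℤ = n · 1#
  ⟦ -[1+ n ] ⟧ℤ = - (suc n · 1#)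

  private
    cancel : ∀ x y z → (x + y) - (x + z) ≈ y - z
    cancel x y z = begin
      (x + y) - (x + z)       ≈⟨ +-congˡ (⁻¹-∙-comm x z) ⟨
      (x + y) + (- x + - z)   ≈⟨ +-assoc (x + y) (- x) (- z) ⟨
      ((x + y) + - x) + - z   ≈⟨ +-congʳ (+-congʳ (+-comm x y)) ⟩
      ((y + x) + - x) + - z   ≈⟨ +-congʳ (+-assoc y x (- x)) ⟩
      (y + (x + - x)) + - z   ≈⟨ +-congʳ (+-congˡ (-‿inverseʳ x)) ⟩
      (y + 0#) + - z          ≈⟨ +-congʳ (+-identityʳ y) ⟩
      y - z                   ∎

    ⊖-homo : ∀ m n → ⟦ m ℤ.⊖ n ⟧ℤ ≈ m · 1# - n · 1#
    ⊖-homo m zero = sym (trans (+-congˡ -0#≈0#) (+-identityʳ _))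
    ⊖-homo zero (suc n) = sym (+-identityˡ _)
    ⊖-homo (suc m) (suc n) = begin
      ⟦ suc m ℤ.⊖ suc n ⟧ℤ             ≡⟨ ≡.cong ⟦_⟧ℤ (ℤ.[1+m]⊖[1+n]≡m⊖n m n) ⟩
      ⟦ m ℤ.⊖ n ⟧ℤ                     ≈⟨ ⊖-homo m n ⟩
      m · 1# - n · 1#                  ≈⟨ cancel 1# _ _ ⟨
      (1# + m · 1#) - (1# + n · 1#)    ≈⟨ +-cong (1+× m 1#) (-‿cong (1+× n 1#)) ⟨
      suc m · 1# - suc n · 1#          ∎

    neg-homo : ∀ i → ⟦ ℤ.- i ⟧ℤ ≈ - ⟦ i ⟧ℤ
    neg-homo (+ zero) = sym -0#≈0#
    neg-homo (+ suc n) = refl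
    neg-homo -[1+ n ] = sym (-‿involutive _)

    +-homo : ∀ i j → ⟦ i ℤ.+ j ⟧ℤ ≈ ⟦ i ⟧ℤ + ⟦ j ⟧ℤ
    +-homo (+ m) (+ n) = ×-homo-+ 1# m n
    +-homo (+ m) -[1+ n ] = ⊖-homo m (suc n)
    +-homo -[1+ m ] (+ n) = trans (⊖-homo n (suc m)) (+-comm _ _)
    +-homo -[1+ m ] -[1+ n ] = begin
      - (suc (suc (m ℕ.+ n)) · 1#)      ≡⟨ ≡.cong (λ k → - (suc k · 1#)) (≡.sym (ℕ.+-suc m n)) ⟩
      - ((suc m ℕ.+ suc n) · 1#)        ≈⟨ -‿cong (×-homo-+ 1# (suc m) (suc n)) ⟩
      - (suc m · 1# + suc n · 1#)       ≈⟨ ⁻¹-∙-comm _ _ ⟨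
      - (suc m · 1#) + - (suc n · 1#)   ∎

    pos*-homo : ∀ m j → ⟦ + m ℤ.* j ⟧ℤ ≈ m · 1# * ⟦ j ⟧ℤ
    pos*-homo m (+ n) = trans (reflexive (≡.cong ⟦_⟧ℤ (≡.sym (ℤ.pos-* m n)))) (×1-homo-* m n)
    pos*-homo m -[1+ n ] = begin
      ⟦ + m ℤ.* ℤ.- (+ suc n) ⟧ℤ     ≡⟨ ≡.cong ⟦_⟧ℤ (≡.sym (ℤ.neg-distribʳ-* (+ m) (+ suc n))) ⟩
      ⟦ ℤ.- (+ m ℤ.* + suc n) ⟧ℤ     ≈⟨ neg-homo (+ m ℤ.* + suc n) ⟩
      - ⟦ + m ℤ.* + suc n ⟧ℤ         ≈⟨ -‿cong (pos*-homo m (+ suc n)) ⟩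
      - (m · 1# * suc n · 1#)        ≈⟨ -‿distribʳ-* _ _ ⟩
      m · 1# * - (suc n · 1#)        ∎

    *-homo : ∀ i j → ⟦ i ℤ.* j ⟧ℤ ≈ ⟦ i ⟧ℤ * ⟦ j ⟧ℤ
    *-homo (+ m) j = pos*-homo m j
    *-homo -[1+ m ] j = begin
      ⟦ ℤ.- (+ suc m) ℤ.* j ⟧ℤ      ≡⟨ ≡.cong ⟦_⟧ℤ (≡.sym (ℤ.neg-distribˡ-* (+ suc m) j)) ⟩
      ⟦ ℤ.- (+ suc m ℤ.* j) ⟧ℤ      ≈⟨ neg-homo (+ suc m ℤ.* j) ⟩
      - ⟦ + suc m ℤ.* j ⟧ℤ          ≈⟨ -‿cong (pos*-homo (suc m) j) ⟩
      - (suc m · 1# * ⟦ j ⟧ℤ)       ≈⟨ -‿distribˡ-* _ _ ⟩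
      - (suc m · 1#) * ⟦ j ⟧ℤ       ∎

    -- Equality in the ring need not be decidable, but equality of integers is. With integer
    -- coefficients the solver can therefore recognise that terms cancel.
    coefficients : ℤ.+-*-rawRing ACR.-Raw-AlmostCommutative⟶ ACR.fromCommutativeRing R
    coefficients = record
      { ⟦_⟧ = ⟦_⟧ℤ ; +-homo = +-homo ; *-homo = *-homo ; -‿homo = neg-homo ; 0-homo = refl ; 1-homo = refl }

    ℤ-equal? : ∀ i j → Maybe (⟦ i ⟧ℤ ≈ ⟦ j ⟧ℤ)
    ℤ-equal? i j with i ℤ.≟ j
    ... | yes i≡j = just (reflexive (≡.cong ⟦_⟧ℤ i≡j))
    ... | no _ = nothing

  open Algebra.Solver.Ring ℤ.+-*-rawRing (ACR.fromCommutativeRing R) coefficients ℤ-equal? public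
    using (solve; con; _:=_; _:+_; _:*_; _:-_; :-_)

  :0 :1 : ∀ {n} → Algebra.Solver.Ring.Polynomial ℤ.+-*-rawRing (ACR.fromCommutativeRing R) coefficients ℤ-equal? n
  :0 = con (+ 0)
  :1 = con (+ 1)


-- Binomial coefficients modulo p and additivity of Frobenius

prime∤! : ∀ {p} → Prime p → ∀ k → k ℕ.< p → ¬ (p ∣ k ℕ.!)
prime∤! pr zero _ p∣1 = ℕ.<⇒≱ (ℕ.nonTrivial⇒n>1 _ {{prime⇒nonTrivial pr}}) (∣⇒≤ p∣1)
prime∤! pr (suc k) k<p p∣ with euclidsLemma (suc k) (k ℕ.!) pr p∣
... | inj₁ p∣k = ℕ.<⇒≱ k<p (∣⇒≤ p∣k)
... | inj₂ p∣k! = prime∤! pr k (ℕ.<-trans (ℕ.n<1+n k) k<p) p∣k!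

-- The product of the binomial coefficient with k! (p - k)! is p!, which p divides. Euclid's lemma
-- leaves only the binomial coefficient, since both factorials are products of numbers below p.
prime∣C : ∀ {p} → Prime p → ∀ {k} → 0 ℕ.< k → k ℕ.< p → p ∣ p C k
prime∣C {suc q} pr {suc k} _ k<p
  with euclidsLemma (suc q C suc k) (suc k ℕ.! ℕ.* (q ℕ.∸ k) ℕ.!) pr
         (≡.subst (suc q ∣_) (≡.sym eq) (m∣m*n (q ℕ.!)))
  where
    instance
      d≢0 : ℕ.NonZero (suc k ℕ.! ℕ.* (q ℕ.∸ k) ℕ.!)
      d≢0 = ℕ.m*n≢0 _ _ {{suc k ℕ.!≢0}} {{(q ℕ.∸ k) ℕ.!≢0}}
    eq : (suc q C suc k) ℕ.* (suc k ℕ.! ℕ.* (q ℕ.∸ k) ℕ.!) ≡ suc q ℕ.!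
    eq = ≡.trans (≡.cong (ℕ._* (suc k ℕ.! ℕ.* (q ℕ.∸ k) ℕ.!)) (nCk≡n!/k![n-k]! (ℕ.<⇒≤ k<p)))
                 (ℕ.m/n*n≡m (k![n∸k]!∣n! (ℕ.<⇒≤ k<p)))
... | inj₁ p∣C = p∣C
... | inj₂ p∣d with euclidsLemma (suc k ℕ.!) ((q ℕ.∸ k) ℕ.!) pr p∣d
...   | inj₁ d = contradiction d (prime∤! pr (suc k) k<p)
...   | inj₂ d = contradiction d (prime∤! pr (q ℕ.∸ k) (ℕ.s≤s (ℕ.m∸n≤m q k)))

FrobeniusAdditive : {c ℓ : Level} → CommutativeRing c ℓ → ℕ → Set (c ⊔ ℓ)
FrobeniusAdditive S p = ∀ x y → (x + y) ^ p ≈ x ^ p + y ^ p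
  where
  open CommutativeRing S
  open Algebra.Properties.CommutativeSemiring.Exp commutativeSemiring

module Frobenius {c ℓ : Level} (R : CommutativeRing c ℓ) where
  open CommutativeRing R hiding (zero)
  open Algebra.Properties.CommutativeSemiring.Exp commutativeSemiring
  open Algebra.Properties.CommutativeSemiring.Binomial commutativeSemiring
  open Algebra.Properties.Semiring.Mult semiring using (×1-homo-*; ×-assoc-*; ×-congʳ; ×-homo-1)
    renaming (_×_ to _·_)
  open Algebra.Properties.Monoid.Sum +-monoid using (sum; sum-cong-≋; sum-init-last; sum-replicate-zero)
  open import Relation.Binary.Reasoning.Setoid setoid

  ·ₙ≈× : ∀ n x → _·ₙ_ R n x ≈ n · x
  ·ₙ≈× zero x = refl
  ·ₙ≈× (suc n) x = +-congˡ (·ₙ≈× n x)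

  module _ {p : ℕ} (pr : Prime p) (char : IsFpAlgebra R p) where

    p∣⇒·≈0 : ∀ {n} x → p ∣ n → n · x ≈ 0#
    p∣⇒·≈0 x (divides q ≡.refl) = begin
      (q ℕ.* p) · x            ≈⟨ ×-congʳ (q ℕ.* p) (*-identityˡ x) ⟨
      (q ℕ.* p) · (1# * x)     ≈⟨ ×-assoc-* (q ℕ.* p) 1# x ⟨
      ((q ℕ.* p) · 1#) * x     ≈⟨ *-congʳ (×1-homo-* q p) ⟩
      (q · 1# * p · 1#) * x    ≈⟨ *-congʳ (*-congˡ (trans (sym (·ₙ≈× p 1#)) char)) ⟩
      (q · 1# * 0#) * x        ≈⟨ *-congʳ (zeroʳ _) ⟩
      0# * x                   ≈⟨ zeroˡ x ⟩
      0#                       ∎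

    frobenius-+ : FrobeniusAdditive R p
    -- The exponent becomes a variable `n` equal to `p`, so that it can be matched as a successor
    -- when the first and last binomial terms are split off.
    frobenius-+ x y = go p pr ≡.refl
      where
      go : ∀ n → Prime n → n ≡ p → (x + y) ^ n ≈ x ^ n + y ^ n
      go zero pr′ _ = contradiction (ℕ.nonTrivial⇒n>1 0 {{prime⇒nonTrivial pr′}}) λ ()
      go (suc n) pr′ ≡.refl = begin
        (x + y) ^ suc n
          ≈⟨ theorem (suc n) x y ⟩
        term zero + sum (term ∘ suc)
          ≈⟨ +-congˡ (sum-init-last (term ∘ suc)) ⟩
        term zero + (sum (term ∘ suc ∘ inject₁) + term (suc (fromℕ n)))
          ≈⟨ +-cong first (+-cong middle last′) ⟩
        y ^ suc n + (0# + x ^ suc n)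
          ≈⟨ +-congˡ (+-identityˡ _) ⟩
        y ^ suc n + x ^ suc n
          ≈⟨ +-comm _ _ ⟩
        x ^ suc n + y ^ suc n ∎
        where
        term = binomialTerm x y (suc n)
        first : term zero ≈ y ^ suc n
        first = trans (×-homo-1 _) (*-identityˡ _)
        middle : sum (term ∘ suc ∘ inject₁) ≈ 0#
        middle = trans (sum-cong-≋ {n = n} λ k → p∣⇒·≈0 _
          (prime∣C pr′ (ℕ.s≤s ℕ.z≤n) (ℕ.s≤s (≡.subst (ℕ._< n) (≡.sym (Fin.toℕ-inject₁ k)) (Fin.toℕ<n k)))))
          (sum-replicate-zero n)
        last′ : term (suc (fromℕ n)) ≈ x ^ suc n
        last′ rewrite Fin.toℕ-fromℕ n | nCn≡1 (suc n) | ℕ.n∸n≡0 n = trans (×-homo-1 _) (*-identityʳ _)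

-- Units and the Jacobson radical

module RingFacts {c ℓ : Level} (R : CommutativeRing c ℓ) where
  open CommutativeRing R hiding (zero)
  open IntegerSolver R
  open Algebra.Properties.CommutativeSemiring.Exp commutativeSemiring
  open import Relation.Binary.Reasoning.Setoid setoid

  unit-resp : ∀ {x y} → x ≈ y → IsUnit R x → IsUnit R y
  unit-resp x≈y (z , xz≈1) = z , trans (*-congʳ (sym x≈y)) xz≈1

  unit-1 : IsUnit R 1#
  unit-1 = 1# , *-identityˡ 1#

  unit-* : ∀ {x y} → IsUnit R x → IsUnit R y → IsUnit R (x * y)
  unit-* {x} {y} (x′ , xx′) (y′ , yy′) = x′ * y′ , (begin
    x * y * (x′ * y′)    ≈⟨ solve 4 (λ x y u v → x :* y :* (u :* v) := x :* u :* (y :* v)) refl x y x′ y′ ⟩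
    x * x′ * (y * y′)    ≈⟨ *-cong xx′ yy′ ⟩
    1# * 1#              ≈⟨ *-identityˡ 1# ⟩
    1#                   ∎)

  unit-factor : ∀ {x y} → IsUnit R (x * y) → IsUnit R x
  unit-factor {x} {y} (z , xyz) = y * z , trans (sym (*-assoc x y z)) xyz

  unit-neg : ∀ {x} → IsUnit R x → IsUnit R (- x)
  unit-neg {x} (y , xy) = - y , trans (solve 2 (λ x y → :- x :* :- y := x :* y) refl x y) xy

  unit-^ : ∀ {x} n → IsUnit R x → IsUnit R (x ^ n)
  unit-^ zero _ = unit-1
  unit-^ (suc n) ux = unit-* ux (unit-^ n ux)

  -- The elementwise description of the intersection of all maximal ideals; it lets the radical be
  -- used without producing any maximal ideal.
  Jacobson : Carrier → Set (c ⊔ ℓ)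
  Jacobson x = ∀ y → IsUnit R (1# + x * y)

  J-resp : ∀ {x y} → x ≈ y → Jacobson x → Jacobson y
  J-resp x≈y jx z = unit-resp (+-congˡ (*-congʳ x≈y)) (jx z)

  J-0 : Jacobson 0#
  J-0 y = unit-resp (sym (trans (+-congˡ (zeroˡ y)) (+-identityʳ 1#))) unit-1

  -- Factor out the unit: u + x = u (1 + x v), where v is the inverse of u.
  J-unit+ : ∀ {u x} → IsUnit R u → Jacobson x → IsUnit R (u + x)
  J-unit+ {u} {x} uu@(v , uv) jx = unit-resp (begin
    u * (1# + x * v)    ≈⟨ solve 3 (λ u v x → u :* (:1 :+ x :* v) := u :+ (u :* v) :* x) refl u v x ⟩
    u + u * v * x       ≈⟨ +-congˡ (trans (*-congʳ uv) (*-identityˡ x)) ⟩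
    u + x               ∎) (unit-* uu (jx v))

  J-*ʳ : ∀ {x} y → Jacobson x → Jacobson (x * y)
  J-*ʳ {x} y jx z = unit-resp (+-congˡ (sym (*-assoc x y z))) (jx (y * z))

  J-*ˡ : ∀ {x} y → Jacobson x → Jacobson (y * x)
  J-*ˡ {x} y jx = J-resp (*-comm x y) (J-*ʳ y jx)

  J-+ : ∀ {x y} → Jacobson x → Jacobson y → Jacobson (x + y)
  J-+ {x} {y} jx jy z = unit-resp
    (solve 3 (λ x y z → :1 :+ x :* z :+ y :* z := :1 :+ (x :+ y) :* z) refl x y z)
    (J-unit+ (jx z) (J-*ʳ z jy))

  J-neg : ∀ {x} → Jacobson x → Jacobson (- x)
  J-neg {x} jx = J-resp (solve 1 (λ x → :- :1 :* x := :- x) refl x) (J-*ˡ (- 1#) jx)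

  J-cancelʳ : ∀ {x u} → IsUnit R u → Jacobson (x * u) → Jacobson x
  J-cancelʳ {x} {u} (v , uv) j = J-resp (begin
    x * u * v     ≈⟨ *-assoc x u v ⟩
    x * (u * v)   ≈⟨ *-congˡ uv ⟩
    x * 1#        ≈⟨ *-identityʳ x ⟩
    x             ∎) (J-*ʳ v j)

-- Artin-Schreier equations on the ideal tS

ArtinSchreierImage : {c ℓ : Level} (S : CommutativeRing c ℓ) → ℕ → (t g : CommutativeRing.Carrier S) → Set (c ⊔ ℓ)
ArtinSchreierImage S p t g = Σ Carrier λ η → (t * η) ^ p - t * η ≈ g
  where
  open CommutativeRing S
  open Algebra.Properties.CommutativeSemiring.Exp commutativeSemiring

IsHenselianPair : {c ℓ : Level} → CommutativeRing c ℓ → Set (c ⊔ ℓ)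
IsHenselianPair R = ∀ as b → Jacobson (eval R (monic R as) b) → IsUnit R (eval R (deriv R (monic R as)) b) →
  Σ Carrier λ b′ → eval R (monic R as) b′ ≈ 0# × Jacobson (b′ - b)
  where
  open CommutativeRing R
  open RingFacts R using (Jacobson)

strictlyMonotone⇒injective : (f : ℕ → ℕ) → (∀ {m n} → m ℕ.< n → f m ℕ.< f n) → ∀ {m n} → f m ≡ f n → m ≡ n
strictlyMonotone⇒injective f mono {m} {n} eq with ℕ.<-cmp m n
... | tri< m<n _ _ = contradiction eq (ℕ.<⇒≢ (mono m<n))
... | tri≈ _ m≡n _ = m≡n
... | tri> _ _ n<m = contradiction (≡.sym eq) (ℕ.<⇒≢ (mono n<m))

module ArtinSchreier {c ℓ : Level} (S : CommutativeRing c ℓ) (r : ℕ) (frobenius-+ : FrobeniusAdditive S (suc (suc r)))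
  (t : CommutativeRing.Carrier S) (t-Jacobson : RingFacts.Jacobson S t) where

  open CommutativeRing S hiding (zero)
  open Algebra.Properties.CommutativeSemiring.Exp commutativeSemiring
  open IntegerSolver S
  open RingFacts S
  open Algebra.Properties.Ring ring using (-0#≈0#)
  open Algebra.Properties.Semiring.Sum semiring using (sum; *-distribˡ-sum)
  open import Relation.Binary.Reasoning.Setoid setoid

  private
    -- The prime is given as r + 2, so that powers with exponents p and q = p - 1 unfold by
    -- computation.
    q p : ℕ
    q = suc r
    p = suc q

  -- Additivity applied to x + (-x) = 0 covers odd p and p = 2 at once.
  frobenius-neg : ∀ x → (- x) ^ p ≈ - (x ^ p)
  frobenius-neg x = begin
    (- x) ^ p                      ≈⟨ solve 2 (λ a b → a := (b :+ a) :- b) refl ((- x) ^ p) (x ^ p) ⟩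
    (x ^ p + (- x) ^ p) - x ^ p    ≈⟨ +-congʳ (frobenius-+ x (- x)) ⟨
    (x - x) ^ p - x ^ p            ≈⟨ +-congʳ (^-congˡ p (-‿inverseʳ x)) ⟩
    0# ^ p - x ^ p                 ≈⟨ +-congʳ (zeroˡ _) ⟩
    0# - x ^ p                     ≈⟨ +-identityˡ _ ⟩
    - (x ^ p)                      ∎

  -- An element of tS is represented as `t * η`, which makes membership in `H` an existential
  -- condition on `η` with `t` as a parameter. Additivity of Frobenius makes `H` a subgroup.
  H : Carrier → Set (c ⊔ ℓ)
  H = ArtinSchreierImage S p t

  H-resp : ∀ {g h} → g ≈ h → H g → H h
  H-resp g≈h (η , eq) = η , trans eq g≈h

  H-0 : H 0#
  H-0 = 0# , (begin
    (t * 0#) ^ p - t * 0#    ≈⟨ +-cong (^-congˡ p (zeroʳ t)) (-‿cong (zeroʳ t)) ⟩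
    0# ^ p - 0#              ≈⟨ +-cong (zeroˡ _) -0#≈0# ⟩
    0# + 0#                  ≈⟨ +-identityˡ 0# ⟩
    0#                       ∎)

  H-+ : ∀ {g h} → H g → H h → H (g + h)
  H-+ {g} {h} (η , eη) (θ , eθ) = η + θ , (begin
    (t * (η + θ)) ^ p - t * (η + θ)                ≈⟨ +-cong (^-congˡ p (distribˡ t η θ)) (-‿cong (distribˡ t η θ)) ⟩
    (t * η + t * θ) ^ p - (t * η + t * θ)          ≈⟨ +-congʳ (frobenius-+ _ _) ⟩
    (t * η) ^ p + (t * θ) ^ p - (t * η + t * θ)    ≈⟨ solve 4 (λ a b c d → a :+ b :- (c :+ d) := a :- c :+ (b :- d)) refl _ _ _ _ ⟩
    (t * η) ^ p - t * η + ((t * θ) ^ p - t * θ)    ≈⟨ +-cong eη eθ ⟩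
    g + h                                          ∎)

  H-neg : ∀ {g} → H g → H (- g)
  H-neg {g} (η , eη) = - η , (begin
    (t * - η) ^ p - t * - η        ≈⟨ +-cong (^-congˡ p t-η) (-‿cong t-η) ⟩
    (- (t * η)) ^ p - - (t * η)    ≈⟨ +-congʳ (frobenius-neg _) ⟩
    - ((t * η) ^ p) - - (t * η)    ≈⟨ solve 2 (λ a b → :- a :- :- b := :- (a :- b)) refl _ _ ⟩
    - ((t * η) ^ p - t * η)        ≈⟨ -‿cong eη ⟩
    - g                            ∎)
    where t-η = solve 2 (λ t η → t :* :- η := :- (t :* η)) refl t η

  -- Congruence modulo the subgroup `H` is expressed as `H (x - y)`; this and the next two lemmas
  -- are the rules for calculating with it.
  H-trans : ∀ {x y z} → H (x - y) → H (y - z) → H (x - z)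
  H-trans {x} {y} {z} a b = H-resp (solve 3 (λ x y z → (x :- y) :+ (y :- z) := x :- z) refl x y z) (H-+ a b)

  H-transport : ∀ {x y} → H (x - y) → H y → H x
  H-transport {x} {y} a b = H-resp (solve 2 (λ x y → (x :- y) :+ y := x) refl x y) (H-+ a b)

  H-swap : ∀ {x y} → H (x - y) → H (y - x)
  H-swap {x} {y} h = H-resp (solve 2 (λ x y → :- (x :- y) := y :- x) refl x y) (H-neg h)

  -- Iterated Frobenius and products over 𝔽ₚ-spans

  frob : ℕ → Carrier → Carrier
  frob zero x = x
  frob (suc n) x = frob n x ^ p

  frob-cong : ∀ n {x y} → x ≈ y → frob n x ≈ frob n y
  frob-cong zero e = e
  frob-cong (suc n) e = ^-congˡ p (frob-cong n e)

  ^-comm : ∀ x m n → (x ^ m) ^ n ≈ (x ^ n) ^ m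
  ^-comm x m n = trans (^-assocʳ x m n) (trans (^-congʳ x (ℕ.*-comm m n)) (sym (^-assocʳ x n m)))

  frob-^ : ∀ n x k → frob n (x ^ k) ≈ frob n x ^ k
  frob-^ zero x k = refl
  frob-^ (suc n) x k = trans (^-congˡ p (frob-^ n x k)) (^-comm _ k p)

  frob-* : ∀ n x y → frob n (x * y) ≈ frob n x * frob n y
  frob-* zero x y = refl
  frob-* (suc n) x y = trans (^-congˡ p (frob-* n x y)) (^-distrib-* _ _ p)

  frob-minus : ∀ n x y → frob n (x - y) ≈ frob n x - frob n y
  frob-minus zero x y = refl
  frob-minus (suc n) x y = begin
    frob n (x - y) ^ p                    ≈⟨ ^-congˡ p (frob-minus n x y) ⟩
    (frob n x - frob n y) ^ p             ≈⟨ frobenius-+ _ _ ⟩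
    frob n x ^ p + (- frob n y) ^ p       ≈⟨ +-congˡ (frobenius-neg _) ⟩
    frob n x ^ p - frob n y ^ p           ∎

  -- As pⁿ ≥ n + 1, the power t^(pⁿ) is divisible by t^(n+1). In the inductive step two of the p
  -- factors `g′` are used: one provides the old power of t, the other one more factor t.
  frob-t : ∀ n → Σ Carrier λ y → t ^ n * (t * y) ≈ frob n t
  frob-t zero = 1# , trans (*-identityˡ _) (*-identityʳ t)
  frob-t (suc n) with frob-t n
  ... | y , eq = y * g * g′ ^ r , (begin
    t * t ^ n * (t * (y * g * g′ ^ r))    ≈⟨ solve 5 (λ t a y g h → t :* a :* (t :* (y :* g :* h)) := a :* (t :* y) :* (t :* g :* h)) refl t (t ^ n) y g (g′ ^ r) ⟩
    g′ * (t * g * g′ ^ r)                 ≈⟨ *-congˡ (*-congʳ (solve 3 (λ t a y → t :* (a :* y) := a :* (t :* y)) refl t (t ^ n) y)) ⟩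
    g′ ^ p                                ≈⟨ ^-congˡ p eq ⟩
    frob n t ^ p                          ∎)
    where
    g = t ^ n * y
    g′ = t ^ n * (t * y)

  -- The difference telescopes. Each summand is sᵖ - s with s = t^(pⁿ), and s lies in tS by
  -- `frob-t`.
  H-frob-t : ∀ n → H (frob n t - t)
  H-frob-t zero = H-resp (sym (-‿inverseʳ t)) H-0
  H-frob-t (suc n) with frob-t n
  ... | y , eq = H-trans (t ^ n * y , (begin
    (t * (t ^ n * y)) ^ p - t * (t ^ n * y)    ≈⟨ +-cong (^-congˡ p e) (-‿cong e) ⟩
    frob (suc n) t - frob n t                  ∎)) (H-frob-t n)
    where e = trans (solve 3 (λ t a y → t :* (a :* y) := a :* (t :* y)) refl t (t ^ n) y) eq

  -- This is the product of w - v over all v in the line 𝔽ₚu, the additive polynomial in w that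
  -- vanishes on that line.
  ℘ : Carrier → Carrier → Carrier
  ℘ u w = w ^ p - u ^ q * w

  ℘-cong : ∀ u {v w} → v ≈ w → ℘ u v ≈ ℘ u w
  ℘-cong u e = +-cong (^-congˡ p e) (-‿cong (*-congˡ e))

  ℘-0 : ∀ u → ℘ u 0# ≈ 0#
  ℘-0 u = trans (+-cong (zeroˡ _) (trans (-‿cong (zeroʳ _)) -0#≈0#)) (+-identityˡ 0#)

  ℘-self : ∀ u → ℘ u u ≈ 0#
  ℘-self u = solve 2 (λ u a → u :* a :- a :* u := :0) refl u (u ^ q)

  -- The product of w - v over the 𝔽ₚ-span of us.
  P : ∀ n → (Fin n → Carrier) → Carrier → Carrier
  P zero us w = w
  P (suc n) us w = P n (λ j → ℘ (us zero) (us (suc j))) (℘ (us zero) w)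

  P-cong : ∀ n us {v w} → v ≈ w → P n us v ≈ P n us w
  P-cong zero us e = e
  P-cong (suc n) us e = P-cong n _ (℘-cong (us zero) e)

  P-0 : ∀ n us → P n us 0# ≈ 0#
  P-0 zero us = refl
  P-0 (suc n) us = trans (P-cong n _ (℘-0 (us zero))) (P-0 n _)

  -- The stage belonging to `us j` sends the image of that entry to 0, and every later stage fixes
  -- 0.
  P-root : ∀ n us j → P n us (us j) ≈ 0#
  P-root (suc n) us zero = trans (P-cong n _ (℘-self (us zero))) (P-0 n _)
  P-root (suc n) us (suc j) = P-root n _ j

  -- Modulo H every multiple g of t is congruent to gᵖ.  Hence, with u the first entry of us,
  -- frob (suc n) w * T is congruent to frob n (℘ u w) * T′ for T = T′ - frob (suc n) u ^ q * T′ᵖ.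
  common-multiplier : ∀ n us y → Σ Carrier λ τ → ∀ w → H (frob n w * (t * τ) - P n us w * (t * y))
  common-multiplier zero us y = y , λ w → H-resp (sym (-‿inverseʳ _)) H-0
  common-multiplier (suc n) us y with common-multiplier n (λ j → ℘ (us zero) (us (suc j))) y
  ... | τ′ , h = τ , λ w → H-trans (H-resp (step w) (H-neg (frob n u ^ q * frob n w * τ′ , refl))) (h (℘ u w))
    where
    u = us zero
    τ = τ′ - frob (suc n) u ^ q * (τ′ * (t * τ′) ^ q)
    step : ∀ w → - ((t * (frob n u ^ q * frob n w * τ′)) ^ p - t * (frob n u ^ q * frob n w * τ′))
                 ≈ frob (suc n) w * (t * τ) - frob n (℘ u w) * (t * τ′)
    step w = begin
      - ((t * (A * b * τ′)) ^ p - t * (A * b * τ′))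
        ≈⟨ -‿cong (+-congʳ (^-congˡ p (solve 4 (λ t A b τ → t :* (A :* b :* τ) := A :* (b :* (t :* τ))) refl t A b τ′))) ⟩
      - ((A * (b * (t * τ′))) ^ p - t * (A * b * τ′))
        ≈⟨ -‿cong (+-congʳ (trans (^-distrib-* A _ p) (*-cong (^-comm _ q p) (^-distrib-* b _ p)))) ⟩
      - (Aᵖ * (b ^ p * (t * τ′ * T)) - t * (A * b * τ′))
        ≈⟨ solve 7 (λ t A b τ Aᵖ bᵖ T → :- (Aᵖ :* (bᵖ :* (t :* τ :* T)) :- t :* (A :* b :* τ))
             := bᵖ :* (t :* (τ :- Aᵖ :* (τ :* T))) :- (bᵖ :- A :* b) :* (t :* τ)) refl t A b τ′ Aᵖ (b ^ p) T ⟩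
      b ^ p * (t * τ) - (b ^ p - A * b) * (t * τ′)
        ≈⟨ +-congˡ (-‿cong (*-congʳ (+-cong (frob-^ n w p) (-‿cong (trans (frob-* n _ w) (*-congʳ (frob-^ n u q))))))) ⟨
      b ^ p * (t * τ) - (frob n (w ^ p) - frob n (u ^ q * w)) * (t * τ′)
        ≈⟨ +-congˡ (-‿cong (*-congʳ (frob-minus n _ _))) ⟨
      b ^ p * (t * τ) - frob n (℘ u w) * (t * τ′) ∎
      where
      A = frob n u ^ q
      Aᵖ = frob (suc n) u ^ q
      b = frob n w
      T = (t * τ′) ^ q

  -- Orders with respect to t

  HasOrder : ℕ → Carrier → Set (c ⊔ ℓ)
  HasOrder e v = Σ Carrier λ w → IsUnit S w × v ≈ t ^ e * w

  -- For v of order e and u of order f, the terms vᵖ and u^q v have orders e + q e and e + q f. The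
  -- formula is the smaller of the two.
  ℘-order : ℕ → ℕ → ℕ
  ℘-order f e = e ℕ.+ q ℕ.* (e ℕ.⊓ f)

  ℘-order-mono : ∀ f {m n} → m ℕ.< n → ℘-order f m ℕ.< ℘-order f n
  ℘-order-mono f m<n = ℕ.+-mono-<-≤ m<n (ℕ.*-monoʳ-≤ q (ℕ.⊓-monoˡ-≤ f (ℕ.<⇒≤ m<n)))

  -- The summand e makes the order strictly increasing in e, so elements of distinct orders still
  -- have distinct orders after applying ℘.
  ℘-order-injective : ∀ f {m n} → ℘-order f m ≡ ℘-order f n → m ≡ n
  ℘-order-injective f = strictlyMonotone⇒injective (℘-order f) (℘-order-mono f)

  private
    tᵉw^q : ∀ e w → (t ^ e * w) ^ q ≈ t ^ (q ℕ.* e) * w ^ q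
    tᵉw^q e w = trans (^-distrib-* _ _ q) (*-congʳ (trans (^-assocʳ t e q) (^-congʳ t (ℕ.*-comm e q))))

    split : ∀ {e f} → e ℕ.< f → t ^ (q ℕ.* f) ≈ t ^ (q ℕ.* e) * (t * t ^ (q ℕ.* f ℕ.∸ suc (q ℕ.* e)))
    split {e} {f} e<f = begin
      t ^ (q ℕ.* f)                          ≡⟨ ≡.cong (t ^_) (≡.sym (ℕ.m+[n∸m]≡n (ℕ.*-monoʳ-< q e<f))) ⟩
      t ^ (suc (q ℕ.* e) ℕ.+ k)              ≡⟨ ≡.cong (t ^_) (≡.sym (ℕ.+-suc (q ℕ.* e) k)) ⟩
      t ^ (q ℕ.* e ℕ.+ suc k)                ≈⟨ ^-homo-* t (q ℕ.* e) (suc k) ⟩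
      t ^ (q ℕ.* e) * (t * t ^ k)            ∎
      where k = q ℕ.* f ℕ.∸ suc (q ℕ.* e)

    t*-J : ∀ x → Jacobson (t * x)
    t*-J x = J-*ʳ x t-Jacobson

  -- Since e ≠ f, the two terms of ℘ cannot cancel to leading order. Once the lower power of t is
  -- factored out, what remains is a unit plus a multiple of t, and this is a unit because t lies in
  -- the Jacobson radical.
  ℘-HasOrder : ∀ {e f u v} → HasOrder f u → HasOrder e v → f ≢ e → HasOrder (℘-order f e) (℘ u v)
  ℘-HasOrder {e} {f} {u} {v} (a , ua , u≈) (b , ub , v≈) f≢e with ℕ.<-cmp e f
  ... | tri≈ _ e≡f _ = contradiction (≡.sym e≡f) f≢e
  ... | tri< e<f _ _ rewrite ℕ.m≤n⇒m⊓n≡m (ℕ.<⇒≤ e<f) = b * w , unit-* ub uw , (begin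
    v * v ^ q - u ^ q * v
      ≈⟨ +-cong (*-cong v≈ (trans (^-congˡ q v≈) (tᵉw^q e b)))
           (-‿cong (*-cong (trans (^-congˡ q u≈) (trans (tᵉw^q f a) (*-congʳ (split e<f)))) v≈)) ⟩
    t ^ e * b * (t ^ (q ℕ.* e) * b ^ q) - t ^ (q ℕ.* e) * (t * d) * a ^ q * (t ^ e * b)
      ≈⟨ solve 7 (λ x b y B t d A → x :* b :* (y :* B) :- y :* (t :* d) :* A :* (x :* b)
           := x :* y :* (b :* (B :+ :- (t :* (d :* A))))) refl (t ^ e) b (t ^ (q ℕ.* e)) (b ^ q) t d (a ^ q) ⟩
    t ^ e * t ^ (q ℕ.* e) * (b * w)
      ≈⟨ *-congʳ (^-homo-* t e (q ℕ.* e)) ⟨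
    t ^ (e ℕ.+ q ℕ.* e) * (b * w) ∎)
    where
    d = t ^ (q ℕ.* f ℕ.∸ suc (q ℕ.* e))
    w = b ^ q + - (t * (d * a ^ q))
    uw = J-unit+ (unit-^ q ub) (J-neg (t*-J (d * a ^ q)))
  ... | tri> _ _ f<e rewrite ℕ.m≥n⇒m⊓n≡n (ℕ.<⇒≤ f<e) = b * w , unit-* ub uw , (begin
    v * v ^ q - u ^ q * v
      ≈⟨ +-cong (*-cong v≈ (trans (^-congˡ q v≈) (trans (tᵉw^q e b) (*-congʳ (split f<e)))))
           (-‿cong (*-cong (trans (^-congˡ q u≈) (tᵉw^q f a)) v≈)) ⟩
    t ^ e * b * (t ^ (q ℕ.* f) * (t * d) * b ^ q) - t ^ (q ℕ.* f) * a ^ q * (t ^ e * b)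
      ≈⟨ solve 7 (λ x b y B t d A → x :* b :* (y :* (t :* d) :* B) :- y :* A :* (x :* b)
           := x :* y :* (b :* (:- A :+ t :* (d :* B)))) refl (t ^ e) b (t ^ (q ℕ.* f)) (b ^ q) t d (a ^ q) ⟩
    t ^ e * t ^ (q ℕ.* f) * (b * w)
      ≈⟨ *-congʳ (^-homo-* t e (q ℕ.* f)) ⟨
    t ^ (e ℕ.+ q ℕ.* f) * (b * w) ∎)
    where
    d = t ^ (q ℕ.* e ℕ.∸ suc (q ℕ.* f))
    w = - (a ^ q) + t * (d * b ^ q)
    uw = J-unit+ (unit-neg (unit-^ q ua)) (t*-J (d * b ^ q))

  -- Each stage of `P` applies one ℘ to all remaining entries and to w. The hypotheses survive
  -- because the orders change by one injective function.
  P-HasOrder : ∀ n us (es : Fin n → ℕ) → (∀ j → HasOrder (es j) (us j)) → (∀ {i j} → es i ≡ es j → i ≡ j) →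
    ∀ {w e} → HasOrder e w → (∀ j → es j ≢ e) → Σ ℕ λ e′ → HasOrder e′ (P n us w)
  P-HasOrder zero us es _ _ {e = e} ord _ = e , ord
  P-HasOrder (suc n) us es ords inj ord ∉ = P-HasOrder n _ (λ j → ℘-order (es zero) (es (suc j)))
    (λ j → ℘-HasOrder (ords zero) (ords (suc j)) λ eq → Fin.0≢1+n (inj eq))
    (λ eq → Fin.suc-injective (inj (℘-order-injective (es zero) eq)))
    (℘-HasOrder (ords zero) ord (∉ zero))
    (λ j eq → ∉ (suc j) (℘-order-injective (es zero) eq))

  H-sum : ∀ {n} (f : Fin n → Carrier) → (∀ j → H (f j)) → H (sum f)
  H-sum {zero} f h = H-0
  H-sum {suc n} f h = H-+ (h zero) (H-sum (f ∘ suc) (h ∘ suc))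

  H-sum-but : ∀ {n} (f : Fin n → Carrier) i → (∀ j → j ≢ i → H (f j)) → H (sum f - f i)
  H-sum-but f zero h = H-resp (solve 2 (λ a b → b := a :+ b :- a) refl (f zero) _) (H-sum (f ∘ suc) λ j → h (suc j) λ ())
  H-sum-but f (suc i) h = H-resp (sym (+-assoc _ _ _))
    (H-+ (h zero λ ()) (H-sum-but (f ∘ suc) i λ j j≢i → h (suc j) (j≢i ∘ Fin.suc-injective)))

  -- Independence of the subgroups defined by H

  ShattersAS : ℕ → Set (c ⊔ ℓ)
  ShattersAS N = Σ (Fin N → Carrier) λ δ → Σ ((Fin N → Bool) → Carrier) λ τ →
    ∀ i J → (J i ≡ true → H (δ i * τ J)) × (H (δ i * τ J) → J i ≡ true)

  -- Row i takes tⁱ as w and the other n powers of t as span. `P` vanishes at the other powers,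
  -- which settles the entries off the diagonal. At tⁱ it has an exact order, so the diagonal entry
  -- can be steered to a power t^(pᵉ); this is congruent to t modulo `H` and hence outside `H`.
  dual-system : ¬ H t → ∀ n → Σ (Fin (suc n) → Carrier) λ δ → Σ (Fin (suc n) → Carrier) λ τ →
    (∀ i j → j ≢ i → H (δ j * τ i)) × (∀ i → ¬ H (δ i * τ i))
  dual-system ¬Ht n = (λ i → frob n (v i)) , (λ i → t * τ i) , off-diagonal , λ i h → ¬Ht (diagonal i h)
    where
    v : Fin (suc n) → Carrier
    v i = t ^ toℕ i
    others : ∀ i → Fin n → Carrier
    others i = v ∘ punchIn i
    ord : ∀ i → HasOrder (toℕ i) (v i)
    ord i = 1# , unit-1 , sym (*-identityʳ _)
    leading : ∀ i → Σ ℕ λ e → HasOrder e (P n (others i) (v i))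
    leading i = P-HasOrder n (others i) (toℕ ∘ punchIn i) (ord ∘ punchIn i)
      (Fin.punchIn-injective i _ _ ∘ Fin.toℕ-injective) (ord i) (λ j → Fin.punchInᵢ≢i i j ∘ Fin.toℕ-injective)
    y : Fin (suc n) → Carrier
    -- The inverse of the unit cofactor of `P` at tⁱ, times the cofactor from `frob-t`: together
    -- they turn tᵉ times a unit into t^(pᵉ).
    y i = proj₁ (proj₁ (proj₂ (proj₂ (leading i)))) * proj₁ (frob-t (proj₁ (leading i)))
    τ : Fin (suc n) → Carrier
    τ i = proj₁ (common-multiplier n (others i) (y i))
    relation : ∀ i w → H (frob n w * (t * τ i) - P n (others i) w * (t * y i))
    relation i = proj₂ (common-multiplier n (others i) (y i))
    off-diagonal : ∀ i j → j ≢ i → H (frob n (v j) * (t * τ i))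
    off-diagonal i j j≢i = H-transport (relation i (v j)) (H-resp (sym (begin
      P n (others i) (v j) * (t * y i)                              ≡⟨ ≡.cong (λ k → P n (others i) (v k) * (t * y i)) (≡.sym (Fin.punchIn-punchOut i≢j)) ⟩
      P n (others i) (others i (punchOut i≢j)) * (t * y i)          ≈⟨ *-congʳ (P-root n (others i) (punchOut i≢j)) ⟩
      0# * (t * y i)                                                ≈⟨ zeroˡ _ ⟩
      0#                                                            ∎)) H-0)
      where i≢j = j≢i ∘ ≡.sym
    diagonal : ∀ i → H (frob n (v i) * (t * τ i)) → H t
    diagonal i h = H-transport (H-swap (H-frob-t e)) (H-resp P≈frob-t (H-transport (H-swap (relation i (v i))) h))
      where
      e = proj₁ (leading i)
      w = proj₁ (proj₂ (leading i))
      w-unit = proj₁ (proj₂ (proj₂ (leading i)))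
      P≈frob-t : P n (others i) (v i) * (t * y i) ≈ frob e t
      P≈frob-t = begin
        P n (others i) (v i) * (t * (proj₁ w-unit * proj₁ (frob-t e)))
          ≈⟨ *-congʳ (proj₂ (proj₂ (proj₂ (leading i)))) ⟩
        t ^ e * w * (t * (proj₁ w-unit * proj₁ (frob-t e)))
          ≈⟨ solve 5 (λ a w t w′ y → a :* w :* (t :* (w′ :* y)) := w :* w′ :* (a :* (t :* y))) refl (t ^ e) w t (proj₁ w-unit) (proj₁ (frob-t e)) ⟩
        w * proj₁ w-unit * (t ^ e * (t * proj₁ (frob-t e)))
          ≈⟨ *-cong (proj₂ w-unit) (proj₂ (frob-t e)) ⟩
        1# * frob e t
          ≈⟨ *-identityˡ _ ⟩
        frob e t ∎

  -- The Baldwin–Saxl argument for the subgroups { τ ∣ H (δ * τ) }.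
  dual-system⇒shatters : ∀ {n} (δ τ : Fin n → Carrier) →
    (∀ i j → j ≢ i → H (δ j * τ i)) → (∀ i → ¬ H (δ i * τ i)) → ShattersAS n
  dual-system⇒shatters {n} δ τ off diag = δ , (λ J → sum (σ J)) , λ i J →
    (λ Ji → to i (J i) Ji (sum-but i J)) , (λ h → from i (J i) h (sum-but i J))
    where
    -- The parameter for J is the sum of the `τ j` with j outside J. Multiplied by `δ i`, all terms
    -- except that of index i fall into `H`.
    pick : Bool → Fin n → Carrier
    pick b j = if b then 0# else τ j
    σ : (Fin n → Bool) → Fin n → Carrier
    σ J j = pick (J j) j
    off′ : ∀ i b j → j ≢ i → H (δ i * pick b j)
    off′ i true j j≢i = H-resp (sym (zeroʳ _)) H-0
    off′ i false j j≢i = off j i (j≢i ∘ ≡.sym)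
    sum-but : ∀ i J → H (δ i * sum (σ J) - δ i * σ J i)
    sum-but i J = H-resp (+-congʳ (sym (*-distribˡ-sum (δ i) (σ J)))) (H-sum-but _ i (λ j → off′ i (J j) j))
    to : ∀ {x} i b → b ≡ true → H (x - δ i * pick b i) → H x
    to i true _ h = H-transport h (H-resp (sym (zeroʳ _)) H-0)
    from : ∀ {x} i b → H x → H (x - δ i * pick b i) → b ≡ true
    from i true _ _ = ≡.refl
    from i false hx h = contradiction (H-transport (H-swap h) hx) (diag i)

  shattersAS : ¬ H t → ∀ N → ShattersAS N
  shattersAS _ zero = (λ ()) , (λ _ → 0#) , λ ()
  shattersAS ¬Ht (suc n) = let δ , τ , off , diag = dual-system ¬Ht n in dual-system⇒shatters δ τ off diag

-- The algebra R[x]/(f) in coordinates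

-- Multiplication in C[x]/(xⁿ + aₙ₋₁xⁿ⁻¹ + … + a₀) on coordinate vectors for 1, x, …, xⁿ⁻¹, n = suc d;
-- X is multiplication by x.  It is used both for elements of a ring and for terms.
module Companion {c : Level} {C : Set c} (_+_ _*_ : C → C → C) (-_ : C → C) (0# 1# : C)
  (d : ℕ) (a : Fin (suc d) → C) where

  M : Set c
  M = Fin (suc d) → C

  shift : M → M
  shift v zero = 0#
  shift v (suc i) = v (inject₁ i)

  X : M → M
  X v i = shift v i + (- (v (fromℕ d) * a i))

  act : List C → M → M
  act [] v i = 0#
  act (u ∷ us) v i = (u * v i) + X (act us v) i

  mul : M → M → M
  mul u v = act (tabulate u) v

  one′ : M
  one′ zero = 1#
  one′ (suc i) = 0#

module CompanionRing {c ℓ : Level} (R : CommutativeRing c ℓ) (d : ℕ) (a : Fin (suc d) → CommutativeRing.Carrier R) where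
  open CommutativeRing R hiding (zero)
  open IntegerSolver R
  open Companion _+_ _*_ -_ 0# 1# d a public
  open Algebra.Properties.Ring ring using (-0#≈0#)
  open import Relation.Binary.Reasoning.Setoid setoid

  infix 4 _≋_
  infixl 6 _⊞_
  infixr 7 _·_

  _≋_ : M → M → Set ℓ
  u ≋ v = ∀ i → u i ≈ v i

  _⊞_ : M → M → M
  (u ⊞ v) i = u i + v i

  _·_ : Carrier → M → M
  (r · v) i = r * v i

  0ᴹ : M
  0ᴹ i = 0#

  ≋-refl : ∀ {u} → u ≋ u
  ≋-refl i = refl
  ≋-sym : ∀ {u v} → u ≋ v → v ≋ u
  ≋-sym e i = sym (e i)
  ≋-trans : ∀ {u v w} → u ≋ v → v ≋ w → u ≋ w
  ≋-trans e f i = trans (e i) (f i)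

  X-cong : ∀ {u v} → u ≋ v → X u ≋ X v
  X-cong e zero = +-congˡ (-‿cong (*-congʳ (e (fromℕ d))))
  X-cong e (suc i) = +-cong (e (inject₁ i)) (-‿cong (*-congʳ (e (fromℕ d))))

  X-+ : ∀ u v → X (u ⊞ v) ≋ X u ⊞ X v
  X-+ u v zero = solve 3 (λ u v a → :0 :- (u :+ v) :* a := (:0 :- u :* a) :+ (:0 :- v :* a)) refl (u (fromℕ d)) (v (fromℕ d)) (a zero)
  X-+ u v (suc i) = solve 5 (λ x y u v a → x :+ y :- (u :+ v) :* a := (x :- u :* a) :+ (y :- v :* a)) refl
    (u (inject₁ i)) (v (inject₁ i)) (u (fromℕ d)) (v (fromℕ d)) (a (suc i))

  X-· : ∀ r v → X (r · v) ≋ r · X v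
  X-· r v zero = solve 3 (λ r v a → :0 :- r :* v :* a := r :* (:0 :- v :* a)) refl r (v (fromℕ d)) (a zero)
  X-· r v (suc i) = solve 4 (λ r x v a → r :* x :- r :* v :* a := r :* (x :- v :* a)) refl r (v (inject₁ i)) (v (fromℕ d)) (a (suc i))

  X-0 : X 0ᴹ ≋ 0ᴹ
  X-0 zero = trans (+-congˡ (trans (-‿cong (zeroˡ _)) -0#≈0#)) (+-identityˡ _)
  X-0 (suc i) = trans (+-congˡ (trans (-‿cong (zeroˡ _)) -0#≈0#)) (+-identityˡ _)

  act-congʳ : ∀ us {v w} → v ≋ w → act us v ≋ act us w
  act-congʳ [] e i = refl
  act-congʳ (u ∷ us) e i = +-cong (*-congˡ (e i)) (X-cong (act-congʳ us e) i)

  act-X : ∀ us v → act us (X v) ≋ X (act us v)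
  act-X [] v i = sym (X-0 i)
  act-X (u ∷ us) v i = sym (begin
    X (act (u ∷ us) v) i                            ≈⟨ X-+ (u · v) (X (act us v)) i ⟩
    X (u · v) i + X (X (act us v)) i                ≈⟨ +-cong (X-· u v i) (X-cong (≋-sym (act-X us v)) i) ⟩
    u * X v i + X (act us (X v)) i                  ∎)

  act-+ : ∀ us v w → act us (v ⊞ w) ≋ act us v ⊞ act us w
  act-+ [] v w i = sym (+-identityˡ 0#)
  act-+ (u ∷ us) v w i = begin
    u * (v i + w i) + X (act us (v ⊞ w)) i                     ≈⟨ +-congˡ (trans (X-cong (act-+ us v w) i) (X-+ (act us v) (act us w) i)) ⟩
    u * (v i + w i) + (X (act us v) i + X (act us w) i)        ≈⟨ solve 5 (λ u v w x y → u :* (v :+ w) :+ (x :+ y) := (u :* v :+ x) :+ (u :* w :+ y)) refl u (v i) (w i) (X (act us v) i) (X (act us w) i) ⟩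
    (u * v i + X (act us v) i) + (u * w i + X (act us w) i)    ∎

  act-· : ∀ us r v → act us (r · v) ≋ r · act us v
  act-· [] r v i = sym (zeroʳ r)
  act-· (u ∷ us) r v i = begin
    u * (r * v i) + X (act us (r · v)) i    ≈⟨ +-congˡ (trans (X-cong (act-· us r v) i) (X-· r (act us v) i)) ⟩
    u * (r * v i) + r * X (act us v) i      ≈⟨ solve 4 (λ u r v x → u :* (r :* v) :+ r :* x := r :* (u :* v :+ x)) refl u r (v i) (X (act us v) i) ⟩
    r * (u * v i + X (act us v) i)          ∎

  -- Both sides compose polynomials in the single linear operator `X`. Commutativity and
  -- associativity of `mul` come from this.
  act-comm : ∀ us ws v → act us (act ws v) ≋ act ws (act us v)
  act-comm [] ws v i = sym (begin
    act ws 0ᴹ i               ≈⟨ act-congʳ ws (λ j → sym (zeroˡ 0#)) i ⟩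
    act ws (0# · 0ᴹ) i        ≈⟨ act-· ws 0# 0ᴹ i ⟩
    0# * act ws 0ᴹ i          ≈⟨ zeroˡ _ ⟩
    0#                        ∎)
  act-comm (u ∷ us) ws v i = sym (begin
    act ws ((u · v) ⊞ X (act us v)) i              ≈⟨ act-+ ws (u · v) (X (act us v)) i ⟩
    act ws (u · v) i + act ws (X (act us v)) i     ≈⟨ +-cong (act-· ws u v i) (act-X ws (act us v) i) ⟩
    u * act ws v i + X (act ws (act us v)) i       ≈⟨ +-congˡ (X-cong (act-comm us ws v) i) ⟨
    u * act ws v i + X (act us (act ws v)) i       ∎)

  coeff : List Carrier → ℕ → Carrier
  coeff [] _ = 0#
  coeff (u ∷ us) zero = u
  coeff (u ∷ us) (suc k) = coeff us k

  coeff-beyond : ∀ us {k} → length us ℕ.≤ k → coeff us k ≡ 0#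
  coeff-beyond [] _ = ≡.refl
  coeff-beyond (u ∷ us) (ℕ.s≤s le) = coeff-beyond us le

  coeff-tabulate : ∀ {n} (u : Fin n → Carrier) i → coeff (tabulate u) (toℕ i) ≡ u i
  coeff-tabulate u zero = ≡.refl
  coeff-tabulate u (suc i) = coeff-tabulate (u ∘ suc) i

  -- `coeff us d` is the coefficient of xⁿ in u ∷ us, the only one that leaves the basis; it is
  -- reduced by xⁿ = -(aₙ₋₁xⁿ⁻¹ + ... + a₀). In `act-one` it vanishes, and for f itself it is 1.
  act-one-step : ∀ u us → (act us one′ ≋ λ i → coeff us (toℕ i)) →
    ∀ i → act (u ∷ us) one′ i ≈ coeff (u ∷ us) (toℕ i) - coeff us d * a i
  act-one-step u us ih zero = begin
    u * 1# + (0# - act us one′ (fromℕ d) * a zero)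
      ≈⟨ +-congˡ (+-congˡ (-‿cong (*-congʳ (trans (ih (fromℕ d)) (reflexive (≡.cong (coeff us) (Fin.toℕ-fromℕ d))))))) ⟩
    u * 1# + (0# - coeff us d * a zero)
      ≈⟨ solve 3 (λ u c a → u :* :1 :+ (:0 :- c :* a) := u :- c :* a) refl u (coeff us d) (a zero) ⟩
    u - coeff us d * a zero ∎
  act-one-step u us ih (suc i) = begin
    u * 0# + (act us one′ (inject₁ i) - act us one′ (fromℕ d) * a (suc i))
      ≈⟨ +-congˡ (+-cong (trans (ih (inject₁ i)) (reflexive (≡.cong (coeff us) (Fin.toℕ-inject₁ i))))
           (-‿cong (*-congʳ (trans (ih (fromℕ d)) (reflexive (≡.cong (coeff us) (Fin.toℕ-fromℕ d))))))) ⟩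
    u * 0# + (coeff us (toℕ i) - coeff us d * a (suc i))
      ≈⟨ solve 4 (λ u x c a → u :* :0 :+ (x :- c :* a) := x :- c :* a) refl u (coeff us (toℕ i)) (coeff us d) (a (suc i)) ⟩
    coeff us (toℕ i) - coeff us d * a (suc i) ∎

  act-one : ∀ us → length us ℕ.≤ suc d → act us one′ ≋ λ i → coeff us (toℕ i)
  act-one [] _ i = refl
  act-one (u ∷ us) (ℕ.s≤s le) i = begin
    act (u ∷ us) one′ i                          ≈⟨ act-one-step u us (act-one us (ℕ.m≤n⇒m≤1+n le)) i ⟩
    coeff (u ∷ us) (toℕ i) - coeff us d * a i    ≈⟨ +-congˡ (-‿cong (trans (*-congʳ (reflexive (coeff-beyond us le))) (zeroˡ _))) ⟩
    coeff (u ∷ us) (toℕ i) - 0#                  ≈⟨ trans (+-congˡ -0#≈0#) (+-identityʳ _) ⟩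
    coeff (u ∷ us) (toℕ i)                       ∎

  mul-identityʳ : ∀ u → mul u one′ ≋ u
  mul-identityʳ u i = trans (act-one (tabulate u) (ℕ.≤-reflexive (length-tabulate u)) i) (reflexive (coeff-tabulate u i))

  -- The vector 1 is cyclic for `X`: both products arise by applying two commuting operators to it.
  mul-comm : ∀ u v → mul u v ≋ mul v u
  mul-comm u v i = begin
    mul u v i               ≈⟨ act-congʳ (tabulate u) (mul-identityʳ v) i ⟨
    mul u (mul v one′) i    ≈⟨ act-comm (tabulate u) (tabulate v) one′ i ⟩
    mul v (mul u one′) i    ≈⟨ act-congʳ (tabulate v) (mul-identityʳ u) i ⟩
    mul v u i               ∎

  mul-cong : ∀ {u v w x} → u ≋ v → w ≋ x → mul u w ≋ mul v x
  mul-cong {u} {v} {w} {x} u≋v w≋x = ≋-trans (act-congʳ (tabulate u) w≋x)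
    (≋-trans (mul-comm u x) (≋-trans (act-congʳ (tabulate x) u≋v) (mul-comm x v)))

  mul-assoc : ∀ u v w → mul (mul u v) w ≋ mul u (mul v w)
  mul-assoc u v w = ≋-trans (mul-comm (mul u v) w) (≋-trans (act-comm (tabulate w) (tabulate u) v)
    (act-congʳ (tabulate u) (mul-comm w v)))

  ring′ : CommutativeRing c ℓ
  ring′ = record
    { Carrier = M
    ; _≈_ = _≋_
    ; _+_ = _⊞_
    ; _*_ = mul
    ; -_ = λ u i → - u i
    ; 0# = 0ᴹ
    ; 1# = one′
    ; isCommutativeRing = record
      { isRing = record
        { +-isAbelianGroup = record
          { isGroup = record
            { isMonoid = record
              { isSemigroup = record
                { isMagma = record
                  { isEquivalence = record { refl = ≋-refl ; sym = ≋-sym ; trans = ≋-trans }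
                  ; ∙-cong = λ e f i → +-cong (e i) (f i) }
                ; assoc = λ u v w i → +-assoc (u i) (v i) (w i) }
              ; identity = (λ u i → +-identityˡ (u i)) , (λ u i → +-identityʳ (u i)) }
            ; inverse = (λ u i → -‿inverseˡ (u i)) , (λ u i → -‿inverseʳ (u i))
            ; ⁻¹-cong = λ e i → -‿cong (e i) }
          ; comm = λ u v i → +-comm (u i) (v i) }
        ; *-cong = λ {u} {v} {w} {x} → mul-cong {u} {v} {w} {x}
        ; *-assoc = mul-assoc
        ; *-identity = (λ u → ≋-trans (mul-comm one′ u) (mul-identityʳ u)) , mul-identityʳ
        ; distrib = (λ u v w → act-+ (tabulate u) v w)
                  , (λ u v w → ≋-trans (mul-comm (v ⊞ w) u) (≋-trans (act-+ (tabulate u) v w)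
                      (λ i → +-cong (mul-comm u v i) (mul-comm u w i)))) }
      ; *-comm = mul-comm } }

-- Nakayama's lemma for submodules of Rⁿ

module Nakayama {c ℓ : Level} (R : CommutativeRing c ℓ) where
  open CommutativeRing R hiding (zero)
  open IntegerSolver R
  open RingFacts R
  open import Relation.Binary.Reasoning.Setoid setoid

  record IsSubmodule {n : ℕ} {p : Level} (P : (Fin n → Carrier) → Set p) : Set (c ⊔ ℓ ⊔ p) where
    field
      resp : ∀ {u v} → (∀ i → u i ≈ v i) → P u → P v
      add : ∀ {u v} → P u → P v → P (λ i → u i + v i)
      scale : ∀ r {v} → P v → P (λ i → r * v i)

  private
    cons : ∀ {n} → Carrier → (Fin n → Carrier) → Fin (suc n) → Carrier
    cons x v zero = x
    cons x v (suc i) = v i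

  -- Gaussian elimination. The first basis vector is congruent modulo P to a vector with coordinates
  -- in J, so P contains a vector whose first coordinate is a unit, and after scaling one of the
  -- form (1, η). It clears first coordinates and reduces the claim to the submodule of vectors that
  -- start with 0.
  nakayama : ∀ {n p} {P : (Fin n → Carrier) → Set p} → IsSubmodule P →
    (∀ (w : Fin n → Carrier) → Σ (Fin n → Carrier) λ z → (∀ i → Jacobson (z i)) × P (λ i → w i - z i)) → ∀ w → P w
  nakayama {zero} sub hyp w = IsSubmodule.resp sub (λ ()) (proj₂ (proj₂ (hyp w)))
  nakayama {suc n} {p} {P} sub hyp w with hyp (cons 1# λ _ → 0#)
  ... | ζ , ζ-J , Pδ-ζ with J-unit+ unit-1 (J-neg (ζ-J zero))
  ...   | v , uv = resp (λ { zero → solve 1 (λ x → x :* :1 :+ :0 := x) refl (w zero)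
                           ; (suc i) → solve 3 (λ w η y → w :* η :+ (y :- w :* η) := y) refl (w zero) (η i) (w (suc i)) })
                       (add (scale (w zero) P1) (tail-all λ i → w (suc i) - w zero * η i))
    where
    open IsSubmodule sub
    η : Fin n → Carrier
    η i = v * (0# - ζ (suc i))
    P1 : P (cons 1# η)
    P1 = resp (λ { zero → trans (*-comm v _) uv ; (suc i) → refl }) (scale v Pδ-ζ)
    P′ : (Fin n → Carrier) → Set p
    P′ x = P (cons 0# x)
    tail-all : ∀ x → P′ x
    tail-all = nakayama {P = P′} (record
      { resp = λ e → resp λ { zero → refl ; (suc i) → e i }
      ; add = λ a b → resp (λ { zero → +-identityˡ 0# ; (suc i) → refl }) (add a b)
      ; scale = λ r a → resp (λ { zero → zeroʳ r ; (suc i) → refl }) (scale r a) })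
      -- The vector (0, x) - z lies in P and starts with -z₀. Adding z₀ (1, η) clears that entry and
      -- leaves the remainder zᵢ - z₀ηᵢ, still in J.
      λ x → let z , z-J , Px-z = hyp (cons 0# x) in
        (λ i → z (suc i) + - (z zero * η i)) ,
        (λ i → J-+ (z-J (suc i)) (J-neg (J-*ʳ _ (z-J zero)))) ,
        resp (λ { zero → solve 1 (λ z → :0 :- z :+ z :* :1 := :0) refl (z zero)
                ; (suc i) → solve 4 (λ x z y e → x :- z :+ y :* e := x :- (z :- y :* e)) refl (x i) (z (suc i)) (z zero) (η i) })
             (add Px-z (scale (z zero) P1))

-- Derivatives and difference quotients

module Derivative {c ℓ : Level} (R : CommutativeRing c ℓ) where
  open CommutativeRing R hiding (zero)
  open IntegerSolver R
  open import Relation.Binary.Reasoning.Setoid setoid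

  weighted : ℕ → List Carrier → List Carrier
  weighted k [] = []
  weighted k (b ∷ bs) = _·ₙ_ R k b ∷ weighted (suc k) bs

  private
    ≡weighted : (g : ℕ → List Carrier → List Carrier) → (∀ k → g k [] ≡ []) →
      (∀ k b bs → g k (b ∷ bs) ≡ _·ₙ_ R k b ∷ g (suc k) bs) → ∀ k bs → g k bs ≡ weighted k bs
    ≡weighted g e1 e2 k [] = e1 k
    ≡weighted g e1 e2 k (b ∷ bs) = ≡.trans (e2 k b bs) (≡.cong (_ ∷_) (≡weighted g e1 e2 (suc k) bs))

  mutual
    private
      -- Solved by unification to the local function in the definition of deriv, which has no name here.
      deriv-go : Carrier → List Carrier → ℕ → List Carrier → List Carrier
      deriv-go = _

    deriv-weighted : ∀ u vs → deriv R (u ∷ vs) ≡ weighted 1 vs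
    deriv-weighted u [] = ≡.refl
    deriv-weighted u (v ∷ vs) with v ∷ vs
    -- Abstraction turns the arguments of the local function into distinct variables, which allows
    -- unification to determine `deriv-go`.
    ... | ws with 2 | vs
    ...   | k | vs′ = ≡.cong (_ ∷_) (≡weighted (deriv-go u ws) (λ _ → ≡.refl) (λ _ _ _ → ≡.refl) k vs′)

  -- For the polynomial f with coefficient list u ∷ vs, the coefficient list of (f(x) - f(b)) / (x - b).
  quotient : Carrier → List Carrier → List Carrier
  quotient b [] = []
  quotient b (v ∷ vs) = eval R (v ∷ vs) b ∷ quotient b vs

  -- Raising every weight by one adds the polynomial itself once.
  eval-weighted-suc : ∀ k vs b → eval R (weighted (suc k) vs) b ≈ eval R (weighted k vs) b + eval R vs b
  eval-weighted-suc k [] b = sym (+-identityˡ 0#)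
  eval-weighted-suc k (v ∷ vs) b = begin
    v + kv + b * eval R (weighted (suc (suc k)) vs) b
      ≈⟨ +-congˡ (*-congˡ (eval-weighted-suc (suc k) vs b)) ⟩
    v + kv + b * (eval R (weighted (suc k) vs) b + eval R vs b)
      ≈⟨ solve 5 (λ v kv b w e → v :+ kv :+ b :* (w :+ e) := kv :+ b :* w :+ (v :+ b :* e)) refl v kv b (eval R (weighted (suc k) vs) b) (eval R vs b) ⟩
    kv + b * eval R (weighted (suc k) vs) b + (v + b * eval R vs b) ∎
    where kv = _·ₙ_ R k v

  eval-weighted-1 : ∀ vs b → eval R (weighted 1 vs) b ≈ eval R (quotient b vs) b
  eval-weighted-1 [] b = refl
  eval-weighted-1 (v ∷ vs) b = begin
    v + 0# + b * eval R (weighted 2 vs) b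
      ≈⟨ +-congˡ (*-congˡ (trans (eval-weighted-suc 1 vs b) (+-congʳ (eval-weighted-1 vs b)))) ⟩
    v + 0# + b * (eval R (quotient b vs) b + eval R vs b)
      ≈⟨ solve 4 (λ v b w e → v :+ :0 :+ b :* (w :+ e) := v :+ b :* e :+ b :* w) refl v b (eval R (quotient b vs) b) (eval R vs b) ⟩
    v + b * eval R vs b + b * eval R (quotient b vs) b ∎

  -- If f = f(b) + (x - b) g, then f′(b) = g(b).
  eval-deriv : ∀ u vs b → eval R (deriv R (u ∷ vs)) b ≈ eval R (quotient b vs) b
  eval-deriv u vs b = trans (reflexive (≡.cong (λ ws → eval R ws b) (deriv-weighted u vs))) (eval-weighted-1 vs b)

-- Lifting idempotents with Artin-Schreier roots

module IdempotentLifting {c ℓ : Level} (S : CommutativeRing c ℓ) (r : ℕ) (frobenius-+ : FrobeniusAdditive S (suc (suc r)))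
  (I : CommutativeRing.Carrier S → Set (c ⊔ ℓ)) (I-ideal : IsIdeal S I)
  (artin-schreier : ∀ t → I t → ArtinSchreierImage S (suc (suc r)) t t) where
  open CommutativeRing S hiding (zero)
  open Algebra.Properties.CommutativeSemiring.Exp commutativeSemiring
  open IsIdeal I-ideal renaming (resp to I-resp; zero∈ to I-0; +-closed to I-+; *-closed to I-*)
  open IntegerSolver S
  open import Relation.Binary.Reasoning.Setoid setoid

  idempotent-^ : ∀ {e} → I (e * e - e) → ∀ k → I (e ^ suc k - e)
  idempotent-^ {e} ie zero = I-resp (solve 1 (λ e → :0 := e :* :1 :- e) refl e) I-0
  idempotent-^ {e} ie (suc k) = I-resp
    (solve 2 (λ e f → e :* (f :- e) :+ (e :* e :- e) := e :* f :- e) refl e (e ^ suc k))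
    (I-+ (I-* e (idempotent-^ ie k)) ie)

  ^-congruent : ∀ {x y} → I (x - y) → ∀ k → I (x ^ k - y ^ k)
  ^-congruent i zero = I-resp (sym (-‿inverseʳ 1#)) I-0
  ^-congruent {x} {y} i (suc k) = I-resp
    (solve 4 (λ x y f g → x :* (f :- g) :+ g :* (x :- y) := x :* f :- y :* g) refl x y (x ^ k) (y ^ k))
    (I-+ (I-* x (^-congruent i k)) (I-* (y ^ k) i))

  -- Correcting e by an Artin–Schreier root b of eᵖ - e gives c = e - b with cᵖ = c, so that cᵖ⁻¹ is idempotent.
  lift-idempotent : ∀ e → I (e * e - e) → Σ Carrier λ ε → ε * ε ≈ ε × I (ε - e)
  lift-idempotent e ie = z ^ suc r , (begin
    z ^ suc r * z ^ suc r      ≈⟨ solve 2 (λ z y → z :* y :* (z :* y) := y :* (z :* (z :* y))) refl z (z ^ r) ⟩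
    z ^ r * z ^ suc (suc r)    ≈⟨ *-congˡ zᵖ≈z ⟩
    z ^ r * z                  ≈⟨ *-comm _ z ⟩
    z ^ suc r                  ∎) ,
    I-resp (solve 3 (λ z f e → (z :- f) :+ (f :- e) := z :- e) refl (z ^ suc r) (e ^ suc r) e)
      (I-+ (^-congruent z-e (suc r)) (idempotent-^ ie r))
    where
    t = e ^ suc (suc r) - e
    t∈I = idempotent-^ ie (suc r)
    η = proj₁ (artin-schreier t t∈I)
    b = t * η
    z = e - b
    z-e : I (z - e)
    z-e = I-resp (solve 3 (λ e t η → (:- η) :* t := e :- t :* η :- e) refl e t η) (I-* (- η) t∈I)
    zᵖ≈z : z ^ suc (suc r) ≈ z
    zᵖ≈z = begin
      z ^ suc (suc r)                          ≈⟨ solve 2 (λ x y → x := (x :+ y) :- y) refl (z ^ suc (suc r)) (b ^ suc (suc r)) ⟩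
      (z ^ suc (suc r) + b ^ suc (suc r)) - b ^ suc (suc r)   ≈⟨ +-congʳ (frobenius-+ z b) ⟨
      (z + b) ^ suc (suc r) - b ^ suc (suc r)  ≈⟨ +-congʳ (^-congˡ (suc (suc r)) (solve 2 (λ e b → e :- b :+ b := e) refl e b)) ⟩
      e ^ suc (suc r) - b ^ suc (suc r)        ≈⟨ solve 4 (λ x y e b → x :- y := (x :- e) :- (y :- b) :+ (e :- b)) refl (e ^ suc (suc r)) (b ^ suc (suc r)) e b ⟩
      t - (b ^ suc (suc r) - b) + z            ≈⟨ +-congʳ (+-congˡ (-‿cong (proj₂ (artin-schreier t t∈I)))) ⟩
      t - t + z                                ≈⟨ +-congʳ (-‿inverseʳ t) ⟩
      0# + z                                   ≈⟨ +-identityˡ z ⟩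
      z                                        ∎

-- Polynomials in S = R[x]/(f) and the ideal JS

module Polynomials {c ℓ : Level} (R : CommutativeRing c ℓ) (d : ℕ) (a : Fin (suc d) → CommutativeRing.Carrier R) where
  private module R = CommutativeRing R
  open RingFacts R
  open Derivative R using (quotient)
  open CompanionRing R d a
  open CommutativeRing ring′ hiding (zero)
  open IntegerSolver ring′
  open import Relation.Binary.Reasoning.Setoid setoid

  ι : R.Carrier → M
  ι r = r · one′

  ι* : ∀ r w → ι r * w ≈ r · w
  ι* r w = begin
    ι r * w            ≈⟨ *-comm (ι r) w ⟩
    w * ι r            ≈⟨ act-· (tabulate w) r one′ ⟩
    r · (w * 1#)       ≈⟨ (λ i → R.*-congˡ (*-identityʳ w i)) ⟩
    r · w              ∎

  ι-cong : ∀ {r s} → r R.≈ s → ι r ≈ ι s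
  ι-cong e i = R.*-congʳ e

  ι-+ : ∀ r s → ι (r R.+ s) ≈ ι r + ι s
  ι-+ r s i = R.distribʳ _ _ _

  ι-* : ∀ r s → ι (r R.* s) ≈ ι r * ι s
  ι-* r s = sym (trans (ι* r (ι s)) (λ i → R.sym (R.*-assoc _ _ _)))

  ι-1 : ι R.1# ≈ 1#
  ι-1 i = R.*-identityˡ _

  x : M
  x = X one′

  x* : ∀ v → x * v ≈ X v
  x* v = begin
    x * v             ≈⟨ *-comm x v ⟩
    v * X one′        ≈⟨ act-X (tabulate v) one′ ⟩
    X (v * 1#)        ≈⟨ X-cong (*-identityʳ v) ⟩
    X v               ∎

  poly : List R.Carrier → M
  poly us = act us one′

  poly-∷ : ∀ u us → poly (u ∷ us) ≈ ι u + x * poly us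
  poly-∷ u us = +-congˡ {ι u} (sym (x* (poly us)))

  poly-tabulate : ∀ w → poly (tabulate w) ≈ w
  poly-tabulate = mul-identityʳ

  -- Synthetic division by x - b, carried out on images in S. The step rewrites x as b + (x - b) in
  -- front of the constant term of the previous stage.
  division : ∀ u vs b → poly (u ∷ vs) ≈ ι (eval R (u ∷ vs) b) + (x - ι b) * poly (quotient b vs)
  division u [] b = begin
    poly (u ∷ [])                                            ≈⟨ poly-∷ u [] ⟩
    ι u + x * 0#                                             ≈⟨ solve 3 (λ u x b → u :+ x :* :0 := u :+ b :* :0 :+ (x :- b) :* :0) refl (ι u) x (ι b) ⟩
    ι u + ι b * 0# + (x - ι b) * 0#                          ≈⟨ +-congʳ (+-congˡ (*-congˡ {ι b} (λ i → R.sym (R.zeroˡ _)))) ⟩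
    ι u + ι b * ι R.0# + (x - ι b) * 0#                      ≈⟨ +-congʳ (trans (ι-+ u (b R.* R.0#)) (+-congˡ (ι-* b R.0#))) ⟨
    ι (eval R (u ∷ []) b) + (x - ι b) * poly []              ∎
  division u (v ∷ vs) b = begin
    poly (u ∷ v ∷ vs)                                        ≈⟨ poly-∷ u (v ∷ vs) ⟩
    ι u + x * poly (v ∷ vs)                                  ≈⟨ +-congˡ (*-congˡ {x} (division v vs b)) ⟩
    ι u + x * (ι e + (x - ι b) * Q)                          ≈⟨ solve 5 (λ u x b e q → u :+ x :* (e :+ (x :- b) :* q) := u :+ b :* e :+ (x :- b) :* (e :+ x :* q)) refl (ι u) x (ι b) (ι e) Q ⟩
    ι u + ι b * ι e + (x - ι b) * (ι e + x * Q)              ≈⟨ +-cong (trans (ι-+ u (b R.* e)) (+-congˡ {ι u} (ι-* b e))) (*-congˡ {x - ι b} (poly-∷ e (quotient b vs))) ⟨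
    ι (eval R (u ∷ v ∷ vs) b) + (x - ι b) * poly (quotient b (v ∷ vs)) ∎
    where
    e = eval R (v ∷ vs) b
    Q = poly (quotient b vs)

  taylor : ∀ us b → Σ M λ h → poly us ≈ ι (eval R us b) + (x - ι b) * h
  taylor [] b = 0# , sym (trans (+-cong {ι R.0#} (λ i → R.zeroˡ _) (zeroʳ (x - ι b))) (+-identityˡ 0#))
  taylor (u ∷ vs) b = poly (quotient b vs) , division u vs b

  -- S is free over R on 1, x, ..., xⁿ⁻¹, so JS is described by coordinates in J.
  JM : M → Set (c ⊔ ℓ)
  JM v = ∀ i → Jacobson (v i)

  JM-X : ∀ {v} → JM v → JM (X v)
  JM-X j zero = J-+ J-0 (J-neg (J-*ʳ _ (j (fromℕ d))))
  JM-X j (suc i) = J-+ (j (inject₁ i)) (J-neg (J-*ʳ _ (j (fromℕ d))))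

  JM-act : ∀ us {v} → JM v → JM (act us v)
  JM-act [] j i = J-0
  JM-act (u ∷ us) j i = J-+ (J-*ˡ u (j i)) (JM-X (JM-act us j) i)

  JM-* : ∀ w {v} → JM v → JM (w * v)
  JM-* w = JM-act (tabulate w)

  JM-+ : ∀ {v w} → JM v → JM w → JM (v + w)
  JM-+ j k i = J-+ (j i) (k i)

  JM-resp : ∀ {v w} → v ≈ w → JM v → JM w
  JM-resp e j i = J-resp (e i) (j i)

  JM-ideal : IsIdeal ring′ JM
  JM-ideal = record { resp = JM-resp ; zero∈ = λ i → J-0 ; +-closed = JM-+ ; *-closed = JM-* }

  JM-ι : ∀ {r} → Jacobson r → JM (ι r)
  JM-ι j i = J-*ʳ _ j

  -- S is finite over R. Modulo JS every w equals (1 + t g) w, so by Nakayama multiplication by 1 +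
  -- t g is onto and reaches 1.
  JM⊆Jacobson : ∀ {t} → JM t → RingFacts.Jacobson ring′ t
  JM⊆Jacobson {t} jt g = nakayama {P = P} (record
    { resp = λ e (s , eq) → s , trans eq e
    ; add = λ (s , es) (s′ , es′) → s + s′ , trans (distribˡ (1# + t * g) s s′) (+-cong es es′)
    ; scale = λ r (s , es) → ι r * s , (begin
        (1# + t * g) * (ι r * s)    ≈⟨ solve 3 (λ a b c → a :* (b :* c) := b :* (a :* c)) refl (1# + t * g) (ι r) s ⟩
        ι r * ((1# + t * g) * s)    ≈⟨ *-congˡ {ι r} es ⟩
        ι r * _                     ≈⟨ ι* r _ ⟩
        r · _                       ∎) })
    (λ w → (- (w * g)) * t , JM-* (- (w * g)) jt , w ,
      solve 3 (λ t g w → (:1 :+ t :* g) :* w := w :- (:- (w :* g)) :* t) refl t g w) 1#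
    where
    open Nakayama R
    P : M → Set (c ⊔ ℓ)
    P w = Σ M λ s → (1# + t * g) * s ≈ w

-- Lifting a simple root

module SimpleRoot {c ℓ : Level} (R : CommutativeRing c ℓ) (a₀ : CommutativeRing.Carrier R) (as : List (CommutativeRing.Carrier R))
  (r : ℕ) (frobenius-+ : FrobeniusAdditive (CompanionRing.ring′ R (length as) (lookup (a₀ ∷ as))) (suc (suc r)))
  (artin-schreier : ∀ t → Polynomials.JM R (length as) (lookup (a₀ ∷ as)) t →
    ArtinSchreierImage (CompanionRing.ring′ R (length as) (lookup (a₀ ∷ as))) (suc (suc r)) t t) where
  open CompanionRing R (length as) (lookup (a₀ ∷ as))
  open CommutativeRing ring′ hiding (zero)
  open Polynomials R (length as) (lookup (a₀ ∷ as))
  private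
    module R = CommutativeRing R
    module RS = IntegerSolver R
    tail : List R.Carrier
    tail = monic R as
  open RingFacts R
  open Derivative R using (quotient; eval-deriv)
  open Nakayama R
  open IntegerSolver ring′
  open import Relation.Binary.Reasoning.Setoid setoid
  open IdempotentLifting ring′ r frobenius-+ JM JM-ideal artin-schreier

  coeff-∷ʳ-lookup : ∀ (us : List R.Carrier) {v} i → coeff (us ∷ʳ v) (toℕ i) ≡ lookup us i
  coeff-∷ʳ-lookup (u ∷ us) zero = ≡.refl
  coeff-∷ʳ-lookup (u ∷ us) (suc i) = coeff-∷ʳ-lookup us i

  coeff-∷ʳ-last : ∀ (us : List R.Carrier) {v} → coeff (us ∷ʳ v) (length us) ≡ v
  coeff-∷ʳ-last [] = ≡.refl
  coeff-∷ʳ-last (u ∷ us) = coeff-∷ʳ-last us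

  -- The difference quotient of a monic polynomial of degree n is monic of degree n - 1. This fixes
  -- the xⁿ⁻¹-coordinate of g.
  coeff-quotient-last : ∀ (us : List R.Carrier) b → coeff (quotient b (monic R us)) (length us) R.≈ R.1#
  coeff-quotient-last [] b = R.trans (R.+-congˡ (R.zeroʳ b)) (R.+-identityʳ R.1#)
  coeff-quotient-last (u ∷ us) b = coeff-quotient-last us b

  length-monic : length tail ≡ suc (length as)
  length-monic = ≡.trans (length-++ as) (ℕ.+-comm (length as) 1)

  length-quotient : ∀ b us → length (quotient b us) ≡ length us
  length-quotient b [] = ≡.refl
  length-quotient b (u ∷ us) = ≡.cong suc (length-quotient b us)

  poly-monic : poly (monic R (a₀ ∷ as)) ≈ 0#
  poly-monic i = R.trans (act-one-step a₀ tail (act-one tail (ℕ.≤-reflexive length-monic)) i)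
    (R.trans (R.+-cong (R.reflexive (coeff-∷ʳ-lookup (a₀ ∷ as) i))
       (R.-‿cong (R.trans (R.*-congʳ (R.reflexive (coeff-∷ʳ-last as))) (R.*-identityˡ _))))
     (R.-‿inverseʳ _))

  hensel : ∀ b → Jacobson (eval R (monic R (a₀ ∷ as)) b) → IsUnit R (eval R (deriv R (monic R (a₀ ∷ as))) b) →
    Σ R.Carrier λ b′ → eval R (monic R (a₀ ∷ as)) b′ R.≈ R.0# × Jacobson (b′ R.- b)
  hensel b fb-J f′b-unit = root , f-root≈0 , J-resp (RS.solve 2 (λ b β → β RS.:= (b RS.:+ β) RS.:- b) R.refl b β) β-J
    where
    f = monic R (a₀ ∷ as)
    fb = eval R f b
    g-coeffs = quotient b tail
    g = poly g-coeffs
    u = eval R g-coeffs b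
    y = x - ι b

    u-unit : IsUnit R u
    u-unit = unit-resp (eval-deriv a₀ tail b) f′b-unit
    u⁻¹ = proj₁ u-unit

    h = proj₁ (taylor g-coeffs b)
    g≈ : g ≈ ι u + y * h
    g≈ = proj₂ (taylor g-coeffs b)

    yg≈ : y * g ≈ - ι fb
    yg≈ = begin
      y * g                      ≈⟨ solve 2 (λ f z → z := (f :+ z) :- f) refl (ι fb) (y * g) ⟩
      (ι fb + y * g) - ι fb      ≈⟨ +-congʳ (trans (sym (division a₀ tail b)) poly-monic) ⟩
      0# - ι fb                  ≈⟨ +-identityˡ (- ι fb) ⟩
      - ι fb                     ∎

    e = ι u⁻¹ * g

    ye≈ : y * e ≈ - ι u⁻¹ * ι fb
    ye≈ = begin
      y * (ι u⁻¹ * g)      ≈⟨ solve 3 (λ y v g → y :* (v :* g) := v :* (y :* g)) refl y (ι u⁻¹) g ⟩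
      ι u⁻¹ * (y * g)      ≈⟨ *-congˡ {ι u⁻¹} yg≈ ⟩
      ι u⁻¹ * - ι fb       ≈⟨ solve 2 (λ v f → v :* :- f := :- v :* f) refl (ι u⁻¹) (ι fb) ⟩
      - ι u⁻¹ * ι fb       ∎

    ye-J : JM (y * e)
    ye-J = JM-resp (sym ye≈) (JM-* (- ι u⁻¹) (JM-ι fb-J))

    e≈ : e ≈ 1# + ι u⁻¹ * (y * h)
    e≈ = begin
      ι u⁻¹ * g                          ≈⟨ *-congˡ {ι u⁻¹} g≈ ⟩
      ι u⁻¹ * (ι u + y * h)              ≈⟨ distribˡ (ι u⁻¹) (ι u) (y * h) ⟩
      ι u⁻¹ * ι u + ι u⁻¹ * (y * h)      ≈⟨ +-congʳ (trans (sym (ι-* u⁻¹ u)) (trans (ι-cong (R.trans (R.*-comm u⁻¹ u) (proj₂ u-unit))) ι-1)) ⟩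
      1# + ι u⁻¹ * (y * h)               ∎

    -- By g(b) = u, e is 1 modulo x - b, while (x - b) e lies in JS. Hence e (e - 1) lies in JS.
    e²-e-J : JM (e * e - e)
    e²-e-J = JM-resp (begin
      ι u⁻¹ * h * (y * e)                  ≈⟨ solve 4 (λ v h y e → v :* h :* (y :* e) := e :* (:1 :+ v :* (y :* h)) :- e) refl (ι u⁻¹) h y e ⟩
      e * (1# + ι u⁻¹ * (y * h)) - e       ≈⟨ +-congʳ (*-congˡ {e} e≈) ⟨
      e * e - e                            ∎) (JM-* (ι u⁻¹ * h) ye-J)

    ε = proj₁ (lift-idempotent e e²-e-J)
    ε²≈ε : ε * ε ≈ ε
    ε²≈ε = proj₁ (proj₂ (lift-idempotent e e²-e-J))
    ε-e-J : JM (ε - e)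
    ε-e-J = proj₂ (proj₂ (lift-idempotent e e²-e-J))

    yε-J : JM (y * ε)
    yε-J = JM-resp (solve 3 (λ y ε e → y :* (ε :- e) :+ y :* e := y :* ε) refl y ε e) (JM-+ (JM-* y ε-e-J) ye-J)

    -- As (x - b)ε ∈ JS, modulo JS every polynomial acts on ε as its value at b.
    ε-generates : ∀ w → Σ R.Carrier λ s → w * ε ≈ ι s * ε
    ε-generates = nakayama {P = λ w → Σ R.Carrier λ s → w * ε ≈ ι s * ε} (record
      { resp = λ {v} {w} e (s , eq) → s , trans (*-congʳ {ε} {w} {v} (sym e)) eq
      ; add = λ {v} {w} (s , es) (s′ , es′) → s R.+ s′ , (begin
          (v + w) * ε               ≈⟨ distribʳ ε v w ⟩
          v * ε + w * ε             ≈⟨ +-cong es es′ ⟩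
          ι s * ε + ι s′ * ε        ≈⟨ distribʳ ε (ι s) (ι s′) ⟨
          (ι s + ι s′) * ε          ≈⟨ *-congʳ {ε} (ι-+ s s′) ⟨
          ι (s R.+ s′) * ε          ∎)
      ; scale = λ k {v} (s , es) → k R.* s , (begin
          (k · v) * ε               ≈⟨ *-congʳ {ε} {k · v} {ι k * v} (sym (ι* k v)) ⟩
          ι k * v * ε               ≈⟨ *-assoc (ι k) v ε ⟩
          ι k * (v * ε)             ≈⟨ *-congˡ {ι k} es ⟩
          ι k * (ι s * ε)           ≈⟨ *-assoc (ι k) (ι s) ε ⟨
          ι k * ι s * ε             ≈⟨ *-congʳ {ε} (ι-* k s) ⟨
          ι (k R.* s) * ε           ∎) })
      -- Write w as w(b) + y hw. The correction `hw * (y * ε)` lies in JS, and since ε² = ε it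
      -- removes y hw after multiplication by ε.
      λ w → let s = eval R (tabulate w) b; hw = proj₁ (taylor (tabulate w) b) in
        hw * (y * ε) , JM-* hw yε-J , s , (begin
          (w - hw * (y * ε)) * ε                     ≈⟨ *-congʳ {ε} (+-congʳ { - (hw * (y * ε))} (trans (sym (poly-tabulate w)) (proj₂ (taylor (tabulate w) b)))) ⟩
          (ι s + y * hw - hw * (y * ε)) * ε          ≈⟨ solve 4 (λ s y h ε → (s :+ y :* h :- h :* (y :* ε)) :* ε := s :* ε :+ y :* h :* (ε :- ε :* ε)) refl (ι s) y hw ε ⟩
          ι s * ε + y * hw * (ε - ε * ε)             ≈⟨ +-congˡ (*-congˡ {y * hw} (trans (+-congˡ (-‿cong ε²≈ε)) (-‿inverseʳ ε))) ⟩
          ι s * ε + y * hw * 0#                      ≈⟨ solve 2 (λ a b → a :+ b :* :0 := a) refl (ι s * ε) (y * hw) ⟩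
          ι s * ε                                    ∎)

    β = proj₁ (ε-generates y)
    yε≈βε : y * ε ≈ ι β * ε
    yε≈βε = proj₂ (ε-generates y)

    top : M → R.Carrier
    top v = v (fromℕ (length as))

    g-top : top g R.≈ R.1#
    g-top = R.trans (act-one g-coeffs (ℕ.≤-reflexive (≡.trans (length-quotient b tail) length-monic)) (fromℕ (length as)))
      (R.trans (R.reflexive (≡.cong (coeff g-coeffs) (Fin.toℕ-fromℕ (length as)))) (coeff-quotient-last as b))

    -- As g is monic, the xⁿ⁻¹-coordinate of e is u⁻¹, and ε differs from e by an element of JS. So
    -- a constant multiplying ε can be recovered from this coordinate; this shows both that β lies
    -- in J and that f vanishes at the root.
    ε-top-unit : IsUnit R (top ε)
    ε-top-unit = unit-resp (RS.solve 2 (λ e ε → e RS.:+ (ε RS.:- e) RS.:= ε) R.refl (top e) (top ε))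
      (J-unit+ (unit-resp (R.sym e-top) u⁻¹-unit) (ε-e-J (fromℕ (length as))))
      where
      e-top : top e R.≈ u⁻¹
      e-top = R.trans (ι* u⁻¹ g (fromℕ (length as))) (R.trans (R.*-congˡ g-top) (R.*-identityʳ u⁻¹))
      u⁻¹-unit : IsUnit R u⁻¹
      u⁻¹-unit = u , R.trans (R.*-comm u⁻¹ u) (proj₂ u-unit)

    β-J : Jacobson β
    β-J = J-cancelʳ ε-top-unit (JM-resp (trans yε≈βε (ι* β ε)) yε-J (fromℕ (length as)))

    root = b R.+ β

    -- On ε, multiplication by x is multiplication by b + β, so f(x) = 0 in S becomes f(b + β) ε =
    -- 0.
    f-root*ε≈0 : ι (eval R f root) * ε ≈ 0#
    f-root*ε≈0 = begin
      ι F * ε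
        ≈⟨ solve 4 (λ F z k ε → F :* ε := (F :+ z :* k) :* ε :- k :* (z :* ε)) refl (ι F) (x - ι root) k ε ⟩
      (ι F + (x - ι root) * k) * ε - k * ((x - ι root) * ε)
        ≈⟨ +-cong (*-congʳ {ε} (trans (sym (proj₂ (taylor f root))) poly-monic))
             (-‿cong (*-congˡ {k} (*-congʳ {ε} (+-congˡ {x} (-‿cong (ι-+ b β)))))) ⟩
      0# * ε - k * ((x - (ι b + ι β)) * ε)
        ≈⟨ solve 5 (λ k x b β ε → :0 :* ε :- k :* ((x :- (b :+ β)) :* ε) := k :* (β :* ε :- (x :- b) :* ε)) refl k x (ι b) (ι β) ε ⟩
      k * (ι β * ε - y * ε)
        ≈⟨ *-congˡ {k} (trans (+-congˡ (-‿cong yε≈βε)) (-‿inverseʳ (ι β * ε))) ⟩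
      k * 0#
        ≈⟨ zeroʳ k ⟩
      0# ∎
      where
      F = eval R f root
      k = proj₁ (taylor f root)

    f-root≈0 : eval R f root R.≈ R.0#
    f-root≈0 = R.trans (R.sym (R.trans (R.*-congˡ (proj₂ ε-top-unit)) (R.*-identityʳ F)))
      (R.trans (R.sym (R.*-assoc F (top ε) v))
      (R.trans (R.*-congʳ (R.trans (R.sym (ι* F ε (fromℕ (length as)))) (f-root*ε≈0 (fromℕ (length as))))) (R.zeroˡ v)))
      where
      F = eval R f root
      v = proj₁ ε-top-unit

-- Interpreting the algebra S in R

exⁿ : ∀ n {k} → Formula (n ℕ.+ k) → Formula k
exⁿ zero φ = φ
exⁿ (suc n) φ = exⁿ n (ex φ)

⋀ : ∀ n {k} → (Fin n → Formula k) → Formula k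
⋀ zero φ = zer ≐ zer
⋀ (suc n) φ = φ zero ∧ ⋀ n (φ ∘ suc)

module Satisfaction {c ℓ : Level} (R : CommutativeRing c ℓ) where
  open CommutativeRing R using (Carrier; refl)

  -- Unlike VF._++_, this reduces on suc n as required by exⁿ.
  prepend : ∀ n {k} → (Fin n → Carrier) → (Fin k → Carrier) → Fin (n ℕ.+ k) → Carrier
  prepend zero η ρ = ρ
  prepend (suc n) η ρ = η zero VF.∷ prepend n (η ∘ suc) ρ

  prepend-↑ˡ : ∀ n {k} η (ρ : Fin k → Carrier) i → prepend n η ρ (i ↑ˡ k) ≡ η i
  prepend-↑ˡ (suc n) η ρ zero = ≡.refl
  prepend-↑ˡ (suc n) η ρ (suc i) = prepend-↑ˡ n (η ∘ suc) ρ i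

  prepend-↑ʳ : ∀ n {k} η (ρ : Fin k → Carrier) i → prepend n η ρ (n ↑ʳ i) ≡ ρ i
  prepend-↑ʳ zero η ρ i = ≡.refl
  prepend-↑ʳ (suc n) η ρ i = prepend-↑ʳ n (η ∘ suc) ρ i

  exⁿ⁺ : ∀ n {k} (φ : Formula (n ℕ.+ k)) ρ η → Sat R φ (prepend n η ρ) → Sat R (exⁿ n φ) ρ
  exⁿ⁺ zero φ ρ η s = s
  exⁿ⁺ (suc n) φ ρ η s = exⁿ⁺ n (ex φ) ρ (η ∘ suc) (η zero , s)

  exⁿ⁻ : ∀ n {k} (φ : Formula (n ℕ.+ k)) ρ → Sat R (exⁿ n φ) ρ → Σ (Fin n → Carrier) λ η → Sat R φ (prepend n η ρ)
  exⁿ⁻ zero φ ρ s = (λ ()) , s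
  exⁿ⁻ (suc n) φ ρ s = let η , x , s′ = exⁿ⁻ n (ex φ) ρ s in (x VF.∷ η) , s′

  ⋀⁺ : ∀ n {k} (φ : Fin n → Formula k) {ρ} → (∀ i → Sat R (φ i) ρ) → Sat R (⋀ n φ) ρ
  ⋀⁺ zero φ s = lift refl
  ⋀⁺ (suc n) φ s = s zero , ⋀⁺ n (φ ∘ suc) (s ∘ suc)

  ⋀⁻ : ∀ n {k} (φ : Fin n → Formula k) {ρ} → Sat R (⋀ n φ) ρ → ∀ i → Sat R (φ i) ρ
  ⋀⁻ (suc n) φ (s , _) zero = s
  ⋀⁻ (suc n) φ (_ , s) (suc i) = ⋀⁻ n (φ ∘ suc) s i

module CompanionTerms (d p : ℕ) where
  n V : ℕ
  n = suc d
  V = n ℕ.+ (n ℕ.+ (n ℕ.+ (n ℕ.+ n)))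

  -- The variables come in blocks of n: first the witness `η`, to be quantified; then the object
  -- tuple `δ`; then the parameters `τ`, `t` and the lower coefficients of f.
  ηᵗ δᵗ τᵗ tᵗ aᵗ : Fin n → Term V
  ηᵗ i = var (i ↑ˡ _)
  δᵗ i = var (n ↑ʳ (i ↑ˡ _))
  τᵗ i = var (n ↑ʳ (n ↑ʳ (i ↑ˡ _)))
  tᵗ i = var (n ↑ʳ (n ↑ʳ (n ↑ʳ (i ↑ˡ _))))
  aᵗ i = var (n ↑ʳ (n ↑ʳ (n ↑ʳ (n ↑ʳ i))))

  open Companion (_⊕_ {V}) _⊗_ neg zer one d aᵗ public

  pow : ℕ → M → M
  pow zero v = one′
  pow (suc k) v = mul v (pow k v)

  lhs : Fin n → Term V
  lhs i = pow p (mul tᵗ ηᵗ) i ⊕ neg (mul tᵗ ηᵗ i)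

  equation : Fin n → Formula V
  equation i = lhs i ≐ mul δᵗ τᵗ i

  -- Says that δτ lies in `H`, with elements of S as n-tuples over R and the equation stated
  -- coordinate by coordinate.
  asFormula : Formula (n ℕ.+ (n ℕ.+ (n ℕ.+ n)))
  asFormula = exⁿ n (⋀ n equation)

  module Interpretation {c ℓ : Level} (R : CommutativeRing c ℓ) (η δ τ t a : Fin n → CommutativeRing.Carrier R) where
    open CommutativeRing R using (Carrier; _+_; _*_; -_; _≈_; 0#)
    open Satisfaction R
    module A = CompanionRing R d a
    open Algebra.Properties.CommutativeSemiring.Exp (CommutativeRing.commutativeSemiring A.ring′) using (_^_)

    ρ : Fin V → Carrier
    ρ = prepend n η (δ VF.++ (τ VF.++ (t VF.++ a)))

    infix 4 _⊩_
    -- Propositional equality is attainable because terms and ring elements are produced by the same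
    -- construction `Companion`.
    _⊩_ : ∀ {k} → (Fin k → Term V) → (Fin k → Carrier) → Set c
    vᵗ ⊩ v = ∀ i → ⟦ R ⟧ₜ (vᵗ i) ρ ≡ v i

    ⊩η : ηᵗ ⊩ η
    ⊩η i = prepend-↑ˡ n η _ i
    ⊩δ : δᵗ ⊩ δ
    ⊩δ i = ≡.trans (prepend-↑ʳ n η _ _) (lookup-++ˡ δ _ i)
    ⊩τ : τᵗ ⊩ τ
    ⊩τ i = ≡.trans (prepend-↑ʳ n η _ _) (≡.trans (lookup-++ʳ δ _ _) (lookup-++ˡ τ _ i))
    ⊩t : tᵗ ⊩ t
    ⊩t i = ≡.trans (prepend-↑ʳ n η _ _) (≡.trans (lookup-++ʳ δ _ _) (≡.trans (lookup-++ʳ τ _ _) (lookup-++ˡ t a i)))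
    ⊩a : aᵗ ⊩ a
    ⊩a i = ≡.trans (prepend-↑ʳ n η _ _) (≡.trans (lookup-++ʳ δ _ _) (≡.trans (lookup-++ʳ τ _ _) (lookup-++ʳ t a i)))

    ⊩X : ∀ vᵗ v → vᵗ ⊩ v → X vᵗ ⊩ A.X v
    ⊩X vᵗ v h zero = ≡.cong₂ (λ x y → 0# + - (x * y)) (h (fromℕ d)) (⊩a zero)
    ⊩X vᵗ v h (suc i) = ≡.cong₂ _+_ (h (inject₁ i)) (≡.cong₂ (λ x y → - (x * y)) (h (fromℕ d)) (⊩a (suc i)))

    ⊩act : ∀ {k} (uᵗ : Fin k → Term V) u vᵗ v → uᵗ ⊩ u → vᵗ ⊩ v → act (tabulate uᵗ) vᵗ ⊩ A.act (tabulate u) v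
    ⊩act {zero} uᵗ u vᵗ v hu hv i = ≡.refl
    ⊩act {suc k} uᵗ u vᵗ v hu hv i = ≡.cong₂ _+_ (≡.cong₂ _*_ (hu zero) (hv i))
      (⊩X _ _ (⊩act (uᵗ ∘ suc) (u ∘ suc) vᵗ v (hu ∘ suc) hv) i)

    ⊩one : one′ ⊩ A.one′
    ⊩one zero = ≡.refl
    ⊩one (suc i) = ≡.refl

    ⊩pow : ∀ k vᵗ v → vᵗ ⊩ v → pow k vᵗ ⊩ v ^ k
    ⊩pow zero vᵗ v h = ⊩one
    ⊩pow (suc k) vᵗ v h = ⊩act vᵗ v (pow k vᵗ) (v ^ k) h (⊩pow k vᵗ v h)

    ⊩tη : mul tᵗ ηᵗ ⊩ A.mul t η
    ⊩tη = ⊩act tᵗ t ηᵗ η ⊩t ⊩η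

    ⊩lhs : ∀ i → ⟦ R ⟧ₜ (lhs i) ρ ≡ (A.mul t η ^ p) i + - A.mul t η i
    ⊩lhs i = ≡.cong₂ _+_ (⊩pow p (mul tᵗ ηᵗ) (A.mul t η) ⊩tη i) (≡.cong -_ (⊩tη i))

    ⊩rhs : mul δᵗ τᵗ ⊩ A.mul δ τ
    ⊩rhs = ⊩act δᵗ δ τᵗ τ ⊩δ ⊩τ

    sat⇒ : Sat R (⋀ n equation) ρ → ∀ i → (A.mul t η ^ p) i + - A.mul t η i ≈ A.mul δ τ i
    sat⇒ s i = ≡.subst₂ _≈_ (⊩lhs i) (⊩rhs i) (lower (⋀⁻ n equation s i))

    ⇒sat : (∀ i → (A.mul t η ^ p) i + - A.mul t η i ≈ A.mul δ τ i) → Sat R (⋀ n equation) ρ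
    ⇒sat e = ⋀⁺ n equation λ i → lift (≡.subst₂ _≈_ (≡.sym (⊩lhs i)) (≡.sym (⊩rhs i)) (e i))

-- NIP implies that (R, J) is a Henselian pair

module NIPHensel {c ℓ : Level} (em : ExcludedMiddle (c ⊔ ℓ)) (R : CommutativeRing c ℓ) {p : ℕ}
  (p-prime : Prime p) (char : IsFpAlgebra R p) (nip : NIP R) where
  open CommutativeRing R hiding (zero)
  open RingFacts R

  companion-char : ∀ d a → IsFpAlgebra (CompanionRing.ring′ R d a) p
  companion-char d a i = trans (go p i) (trans (*-congʳ char) (zeroˡ _))
    where
    open CompanionRing R d a
    go : ∀ k i → _·ₙ_ ring′ k one′ i ≈ _·ₙ_ R k 1# * one′ i
    go zero i = sym (zeroˡ _)
    go (suc k) i = trans (+-cong (sym (*-identityˡ _)) (go k i)) (sym (distribʳ _ _ _))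

  prime-form : ∀ {q} → Prime q → Σ ℕ λ r → q ≡ suc (suc r)
  prime-form {zero} pr = contradiction (ℕ.nonTrivial⇒n>1 0 {{prime⇒nonTrivial pr}}) λ ()
  prime-form {suc zero} pr = contradiction (ℕ.nonTrivial⇒n>1 1 {{prime⇒nonTrivial pr}}) λ { (ℕ.s≤s ()) }
  prime-form {suc (suc r)} pr = r , ≡.refl

  -- An equation without a solution means that t is not in `H`. Then the shattered configurations in
  -- S give `asFormula` the independence property in R, against NIP.
  artin-schreier : ∀ r d a → p ≡ suc (suc r) → ∀ t → Polynomials.JM R d a t →
    ArtinSchreierImage (CompanionRing.ring′ R d a) (suc (suc r)) t t
  artin-schreier r d a ≡.refl t t-J with em {ArtinSchreierImage (CompanionRing.ring′ R d a) p t t}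
  ... | yes solution = solution
  ... | no ¬solution = contradiction independence (nip (suc d) _ (asFormula d p))
    where
    open CompanionTerms using (asFormula)
    open CompanionRing R d a
    open Satisfaction R
    open ArtinSchreier ring′ r (Frobenius.frobenius-+ ring′ p-prime (companion-char d a)) t (Polynomials.JM⊆Jacobson R d a t-J)
    independence : HasIP R (suc d) _ (asFormula d p)
    independence N = let δ , τ , sh = shattersAS ¬solution N in
      δ , (λ J → τ J VF.++ (t VF.++ a)) , λ i J → mk⇔
        (λ s → let η , s′ = exⁿ⁻ (suc d) _ _ s in
          proj₂ (sh i J) (η , CompanionTerms.Interpretation.sat⇒ d p R η (δ i) (τ J) t a s′))
        (λ Ji → let η , e = proj₁ (sh i J) Ji in
          exⁿ⁺ (suc d) _ _ η (CompanionTerms.Interpretation.⇒sat d p R η (δ i) (τ J) t a e))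

  henselian-pair : IsHenselianPair R
  -- Here f is the constant 1 and its derivative is 0. As that is assumed to be a unit, the ring is
  -- trivial and b itself is a root.
  henselian-pair [] b _ (v , 0*v≈1) = b , trivial _ , J-resp (sym (-‿inverseʳ b)) J-0
    where
    trivial : ∀ x → x ≈ 0#
    trivial x = trans (sym (*-identityˡ x)) (trans (*-congʳ (trans (sym 0*v≈1) (zeroˡ v))) (zeroˡ x))
  henselian-pair (a₀ ∷ as) b fb-J f′b-unit with prime-form p-prime
  ... | r , ≡.refl = SimpleRoot.hensel R a₀ as r
    (Frobenius.frobenius-+ (CompanionRing.ring′ R (length as) (lookup (a₀ ∷ as))) p-prime (companion-char (length as) (lookup (a₀ ∷ as))))
    (artin-schreier r (length as) (lookup (a₀ ∷ as)) ≡.refl) b fb-J f′b-unit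

-- The factors eR

module _ {c ℓ : Level} (R : CommutativeRing c ℓ) (e : CommutativeRing.Carrier R) where
  open CommutativeRing R
  open IntegerSolver R
  open import Relation.Binary.Reasoning.Setoid setoid

  -- R / Ann(e); for idempotent e this is the factor eR of R.
  localise : CommutativeRing c ℓ
  localise = record
    { Carrier = Carrier
    ; _≈_ = λ x y → e * x ≈ e * y
    ; _+_ = _+_
    ; _*_ = _*_
    ; -_ = -_
    ; 0# = 0#
    ; 1# = 1#
    ; isCommutativeRing = record
      { isRing = record
        { +-isAbelianGroup = record
          { isGroup = record
            { isMonoid = record
              { isSemigroup = record
                { isMagma = record
                  { isEquivalence = record { refl = refl ; sym = sym ; trans = trans }
                  ; ∙-cong = λ {x} {y} {u} {v} p q → trans (distribˡ e x u) (trans (+-cong p q) (sym (distribˡ e y v))) }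
                ; assoc = λ x y z → *-congˡ (+-assoc x y z) }
              ; identity = (λ x → *-congˡ (+-identityˡ x)) , (λ x → *-congˡ (+-identityʳ x)) }
            ; inverse = (λ x → *-congˡ (-‿inverseˡ x)) , (λ x → *-congˡ (-‿inverseʳ x))
            ; ⁻¹-cong = λ {x} {y} p → begin
                e * - x      ≈⟨ solve 2 (λ e x → e :* :- x := :- (e :* x)) refl e x ⟩
                - (e * x)    ≈⟨ -‿cong p ⟩
                - (e * y)    ≈⟨ solve 2 (λ e x → e :* :- x := :- (e :* x)) refl e y ⟨
                e * - y      ∎ }
          ; comm = λ x y → *-congˡ (+-comm x y) }
        ; *-cong = λ {x} {y} {u} {v} p q → begin
            e * (x * u)    ≈⟨ *-assoc e x u ⟨
            e * x * u      ≈⟨ *-congʳ p ⟩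
            e * y * u      ≈⟨ solve 3 (λ e y u → e :* y :* u := y :* (e :* u)) refl e y u ⟩
            y * (e * u)    ≈⟨ *-congˡ q ⟩
            y * (e * v)    ≈⟨ solve 3 (λ e y u → e :* (y :* u) := y :* (e :* u)) refl e y v ⟨
            e * (y * v)    ∎
        ; *-assoc = λ x y z → *-congˡ (*-assoc x y z)
        ; *-identity = (λ x → *-congˡ (*-identityˡ x)) , (λ x → *-congˡ (*-identityʳ x))
        ; distrib = (λ x y z → *-congˡ (distribˡ x y z)) , (λ x y z → *-congˡ (distribʳ x y z)) }
      ; *-comm = λ x y → *-congˡ (*-comm x y) } }

  localise-char : ∀ {p} → IsFpAlgebra R p → IsFpAlgebra localise p
  localise-char {p} char = *-congˡ (trans (go p) char)
    where
    go : ∀ n → _·ₙ_ localise n 1# ≈ _·ₙ_ R n 1#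
    go zero = refl
    go (suc n) = +-congˡ (go n)

-- Factors inherit NIP

lift-ren : ∀ {n n′} → (Fin n → Fin n′) → Fin (suc n) → Fin (suc n′)
lift-ren ι zero = zero
lift-ren ι (suc i) = suc (ι i)

renᵗ : ∀ {n n′} → (Fin n → Fin n′) → Term n → Term n′
renᵗ ι (var i) = var (ι i)
renᵗ ι zer = zer
renᵗ ι one = one
renᵗ ι (s ⊕ t) = renᵗ ι s ⊕ renᵗ ι t
renᵗ ι (s ⊗ t) = renᵗ ι s ⊗ renᵗ ι t
renᵗ ι (neg t) = neg (renᵗ ι t)

-- `localise R e` has the carrier of R and a coarser equality. Thus quantifiers stay as they are,
-- and only equations change: both sides are multiplied by the variable `z` that stands for e.
relativise : ∀ {n n′} → (Fin n → Fin n′) → Fin n′ → Formula n → Formula n′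
relativise ι z (s ≐ t) = (var z ⊗ renᵗ ι s) ≐ (var z ⊗ renᵗ ι t)
relativise ι z (∼ φ) = ∼ relativise ι z φ
relativise ι z (φ ∧ ψ) = relativise ι z φ ∧ relativise ι z ψ
relativise ι z (φ ∨ ψ) = relativise ι z φ ∨ relativise ι z ψ
relativise ι z (all φ) = all (relativise (lift-ren ι) (suc z) φ)
relativise ι z (ex φ) = ex (relativise (lift-ren ι) (suc z) φ)

module _ {c ℓ : Level} (R : CommutativeRing c ℓ) (e : CommutativeRing.Carrier R) where
  open CommutativeRing R using (Carrier; _+_; _*_; -_; _≈_)

  renᵗ-sound : ∀ {n n′} (ι : Fin n → Fin n′) (t : Term n) {ρ ρ′} → (∀ i → ρ′ (ι i) ≡ ρ i) →
    ⟦ R ⟧ₜ (renᵗ ι t) ρ′ ≡ ⟦ localise R e ⟧ₜ t ρ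
  renᵗ-sound ι (var i) h = h i
  renᵗ-sound ι zer h = ≡.refl
  renᵗ-sound ι one h = ≡.refl
  renᵗ-sound ι (s ⊕ t) h = ≡.cong₂ _+_ (renᵗ-sound ι s h) (renᵗ-sound ι t h)
  renᵗ-sound ι (s ⊗ t) h = ≡.cong₂ _*_ (renᵗ-sound ι s h) (renᵗ-sound ι t h)
  renᵗ-sound ι (neg t) h = ≡.cong -_ (renᵗ-sound ι t h)

  lift-agree : ∀ {n n′} {ι : Fin n → Fin n′} {ρ ρ′} (x : Carrier) → (∀ i → ρ′ (ι i) ≡ ρ i) →
    ∀ i → (x VF.∷ ρ′) (lift-ren ι i) ≡ (x VF.∷ ρ) i
  lift-agree x h zero = ≡.refl
  lift-agree x h (suc i) = h i

  -- The two directions are proved by mutual recursion because negation exchanges them.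
  relativise⁺ : ∀ {n n′} (ι : Fin n → Fin n′) z φ {ρ ρ′} → (∀ i → ρ′ (ι i) ≡ ρ i) → ρ′ z ≡ e →
    Sat (localise R e) φ ρ → Sat R (relativise ι z φ) ρ′
  relativise⁻ : ∀ {n n′} (ι : Fin n → Fin n′) z φ {ρ ρ′} → (∀ i → ρ′ (ι i) ≡ ρ i) → ρ′ z ≡ e →
    Sat R (relativise ι z φ) ρ′ → Sat (localise R e) φ ρ
  relativise⁺ ι z (s ≐ t) h hz (lift eq) = lift (≡.subst₂ _≈_
    (≡.sym (≡.cong₂ _*_ hz (renᵗ-sound ι s h))) (≡.sym (≡.cong₂ _*_ hz (renᵗ-sound ι t h))) eq)
  relativise⁺ ι z (∼ φ) h hz ¬s s = ¬s (relativise⁻ ι z φ h hz s)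
  relativise⁺ ι z (φ ∧ ψ) h hz (s , s′) = relativise⁺ ι z φ h hz s , relativise⁺ ι z ψ h hz s′
  relativise⁺ ι z (φ ∨ ψ) h hz (inj₁ s) = inj₁ (relativise⁺ ι z φ h hz s)
  relativise⁺ ι z (φ ∨ ψ) h hz (inj₂ s) = inj₂ (relativise⁺ ι z ψ h hz s)
  relativise⁺ ι z (all φ) h hz s x = relativise⁺ (lift-ren ι) (suc z) φ (lift-agree x h) hz (s x)
  relativise⁺ ι z (ex φ) h hz (x , s) = x , relativise⁺ (lift-ren ι) (suc z) φ (lift-agree x h) hz s
  relativise⁻ ι z (s ≐ t) h hz (lift eq) = lift (≡.subst₂ _≈_
    (≡.cong₂ _*_ hz (renᵗ-sound ι s h)) (≡.cong₂ _*_ hz (renᵗ-sound ι t h)) eq)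
  relativise⁻ ι z (∼ φ) h hz ¬s s = ¬s (relativise⁺ ι z φ h hz s)
  relativise⁻ ι z (φ ∧ ψ) h hz (s , s′) = relativise⁻ ι z φ h hz s , relativise⁻ ι z ψ h hz s′
  relativise⁻ ι z (φ ∨ ψ) h hz (inj₁ s) = inj₁ (relativise⁻ ι z φ h hz s)
  relativise⁻ ι z (φ ∨ ψ) h hz (inj₂ s) = inj₂ (relativise⁻ ι z ψ h hz s)
  relativise⁻ ι z (all φ) h hz s x = relativise⁻ (lift-ren ι) (suc z) φ (lift-agree x h) hz (s x)
  relativise⁻ ι z (ex φ) h hz (x , s) = x , relativise⁻ (lift-ren ι) (suc z) φ (lift-agree x h) hz s

  -- The element e becomes one further parameter. It is put directly after the k object variables,
  -- and `ι` shifts the old parameters past it.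
  localise-NIP : NIP R → NIP (localise R e)
  localise-NIP nip k m φ ip = nip k (suc m) (relativise ι z φ) λ N →
    let a , b , sh = ip N in
    a , (λ J → e VF.∷ b J) , λ i J → mk⇔
      (λ s → Equivalence.to (sh i J) (relativise⁻ ι z φ (agree (a i) (b J)) (lookup-++ʳ (a i) _ zero) s))
      (λ Ji → relativise⁺ ι z φ (agree (a i) (b J)) (lookup-++ʳ (a i) _ zero) (Equivalence.from (sh i J) Ji))
    where
    ι : Fin (k ℕ.+ m) → Fin (k ℕ.+ suc m)
    ι i = [ _↑ˡ suc m , (λ j → k ↑ʳ suc j) ] (splitAt k i)
    z : Fin (k ℕ.+ suc m)
    z = k ↑ʳ zero
    agree : ∀ x y i → (x VF.++ (e VF.∷ y)) (ι i) ≡ (x VF.++ y) i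
    agree x y i with splitAt k i
    ... | inj₁ j = lookup-++ˡ x (e VF.∷ y) j
    ... | inj₂ j = lookup-++ʳ x (e VF.∷ y) (suc j)

-- Comaximal families and idempotents

module Comaximality {c ℓ : Level} (R : CommutativeRing c ℓ) where
  open CommutativeRing R hiding (zero)
  open IntegerSolver R
  open RingFacts R
  open import Relation.Binary.Reasoning.Setoid setoid

  Comaximal : Carrier → Carrier → Set (c ⊔ ℓ)
  Comaximal x y = Σ Carrier λ u → Σ Carrier λ v → u * x + v * y ≈ 1#

  comaximal-sym : ∀ {x y} → Comaximal x y → Comaximal y x
  comaximal-sym (u , v , eq) = v , u , trans (+-comm _ _) eq

  comaximal-1 : ∀ x → Comaximal x 1#
  comaximal-1 x = 0# , 1# , solve 1 (λ x → :0 :* x :+ :1 :* :1 := :1) refl x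

  comaximal-* : ∀ {x y z} → Comaximal x y → Comaximal x z → Comaximal x (y * z)
  comaximal-* {x} {y} {z} (u , v , eq) (u′ , v′ , eq′) = u * u′ * x + u * v′ * z + v * y * u′ , v * v′ , (begin
    (u * u′ * x + u * v′ * z + v * y * u′) * x + v * v′ * (y * z)
      ≈⟨ solve 7 (λ u u′ v v′ x y z → (u :* u′ :* x :+ u :* v′ :* z :+ v :* y :* u′) :* x :+ v :* v′ :* (y :* z)
           := (u :* x :+ v :* y) :* (u′ :* x :+ v′ :* z)) refl u u′ v v′ x y z ⟩
    (u * x + v * y) * (u′ * x + v′ * z)    ≈⟨ *-cong eq eq′ ⟩
    1# * 1#                                ≈⟨ *-identityˡ 1# ⟩
    1#                                     ∎)

  Π : ∀ {n} → (Fin n → Carrier) → Carrier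
  Π {zero} f = 1#
  Π {suc n} f = f zero * Π (f ∘ suc)

  comaximal-Π : ∀ {n x} (f : Fin n → Carrier) → (∀ i → Comaximal x (f i)) → Comaximal x (Π f)
  comaximal-Π {zero} f h = comaximal-1 _
  comaximal-Π {suc n} f h = comaximal-* (h zero) (comaximal-Π (f ∘ suc) (h ∘ suc))

  Π-factor : ∀ {n} (f : Fin n → Carrier) i → Σ Carrier λ r → Π f ≈ f i * r
  Π-factor f zero = _ , refl
  Π-factor f (suc i) = let r , eq = Π-factor (f ∘ suc) i in f zero * r ,
    trans (*-congˡ eq) (solve 3 (λ a b r → a :* (b :* r) := b :* (a :* r)) refl (f zero) (f (suc i)) r)

  Family : ℕ → Set (c ⊔ ℓ)
  Family n = Σ (Fin n → Carrier) λ b → (∀ i → ¬ IsUnit R (b i)) × (∀ i j → i ≢ j → Comaximal (b i) (b j))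

  family-cons : ∀ {n} x ((b , _) : Family n) → ¬ IsUnit R x → (∀ i → Comaximal x (b i)) → Family (suc n)
  family-cons x (b , nonunit , comax) ¬ux h = x VF.∷ b
    , (λ { zero → ¬ux ; (suc i) → nonunit i })
    , λ { zero zero 0≢0 → contradiction ≡.refl 0≢0
        ; zero (suc j) _ → h j
        ; (suc i) zero _ → comaximal-sym (h i)
        ; (suc i) (suc j) i≢j → comax i j (i≢j ∘ ≡.cong suc) }

  family-0 : Family 0
  family-0 = (λ ()) , (λ ()) , λ ()

  family-tail : ∀ {n} → Family (suc n) → Family n
  family-tail (b , nonunit , comax) = b ∘ suc , nonunit ∘ suc , λ i j i≢j → comax (suc i) (suc j) (i≢j ∘ Fin.suc-injective)

  -- Under the two quantifiers, index 1 is the outer multiplier u and index 0 the inner multiplier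
  -- v; indices 2 and 3 are the object and the parameter.
  comaximalFormula : Formula 2
  comaximalFormula = ex (ex (((var (suc zero) ⊗ var (suc (suc zero))) ⊕ (var zero ⊗ var (suc (suc (suc zero))))) ≐ one))

  -- The parameter for J is the product of the members with index outside J. It is comaximal to
  -- `b i` for i in J; otherwise it is a multiple of the nonunit `b i`, and comaximality would make
  -- `b i` a unit.
  families⇒IP : (∀ n → Family n) → HasIP R 1 1 comaximalFormula
  families⇒IP fam N = (λ i _ → b i) , (λ J _ → Π (f J)) , λ i J → mk⇔
    (λ (u , v , lift eq) → to i J (u , v , eq))
    (λ Ji → let u , v , eq = comaximal-Π (f J) (from i J Ji) in u , v , lift eq)
    where
    b = proj₁ (fam N)
    nonunit = proj₁ (proj₂ (fam N))
    comax = proj₂ (proj₂ (fam N))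
    pick : Bool → Fin N → Carrier
    pick β j = if β then 1# else b j
    f : (Fin N → Bool) → Fin N → Carrier
    f J j = pick (J j) j
    ¬comaximal-multiple : ∀ i {y} → (Σ Carrier λ r → y ≈ b i * r) → ¬ Comaximal (b i) y
    ¬comaximal-multiple i {y} (r , y≈) (u , v , eq) = nonunit i (u + v * r , (begin
      b i * (u + v * r)          ≈⟨ solve 4 (λ b u v r → b :* (u :+ v :* r) := u :* b :+ v :* (b :* r)) refl (b i) u v r ⟩
      u * b i + v * (b i * r)    ≈⟨ +-congˡ (*-congˡ y≈) ⟨
      u * b i + v * y            ≈⟨ eq ⟩
      1#                         ∎))
    to : ∀ i J → Comaximal (b i) (Π (f J)) → J i ≡ true
    to i J cm = go (J i) (Π-factor (f J) i)
      where
      go : ∀ β → (Σ Carrier λ r → Π (f J) ≈ pick β i * r) → β ≡ true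
      go true _ = ≡.refl
      go false h = contradiction cm (¬comaximal-multiple i h)
    from : ∀ i J → J i ≡ true → ∀ j → Comaximal (b i) (f J j)
    from i J Ji j = go (J j) ≡.refl
      where
      go : ∀ β → J j ≡ β → Comaximal (b i) (pick β j)
      go true _ = comaximal-1 _
      go false Jj = comax i j λ { ≡.refl → contradiction (≡.trans (≡.sym Ji) Jj) λ () }

  family-bound : ExcludedMiddle (c ⊔ ℓ) → NIP R → Σ ℕ λ n → ¬ Family n
  family-bound em nip with em {Σ ℕ λ n → ¬ Family n}
  ... | yes bound = bound
  ... | no ¬bound = contradiction (families⇒IP everywhere) (nip 1 1 comaximalFormula)
    where
    everywhere : ∀ n → Family n
    everywhere n with em {Family n}
    ... | yes fam = fam
    ... | no ¬fam = contradiction (n , ¬fam) ¬bound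

  maximal-family : ExcludedMiddle (c ⊔ ℓ) → ∀ m {k} → Family k → ¬ Family (m ℕ.+ k) →
    Σ ℕ λ j → Family (j ℕ.+ k) × ¬ Family (suc (j ℕ.+ k))
  maximal-family em zero fam ¬fam = contradiction fam ¬fam
  maximal-family em (suc m) {k} fam ¬fam with em {Family (m ℕ.+ k)}
  ... | yes fam′ = m , fam′ , ¬fam
  ... | no ¬fam′ = maximal-family em m fam ¬fam′

  family-drop : ∀ m {k} → Family (m ℕ.+ k) → Family k
  family-drop zero fam = fam
  family-drop (suc m) fam = family-drop m (family-tail fam)

  -- As in the Chinese remainder theorem, u b₀ + v B = 1 with B the product of the other members
  -- makes e = v B idempotent modulo the product of all members. The Henselian property lifts e to a
  -- root ε of x² - x. If ε were 0 then b₀ would be a unit, and if ε were 1 then b₁ would be.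
  idempotent-of-family : ExcludedMiddle (c ⊔ ℓ) → IsHenselianPair R →
    ∀ {k} → Family (suc (suc k)) → ¬ Family (suc (suc (suc k))) →
    Σ Carrier λ ε → ε * ε ≈ ε × ¬ ε ≈ 0# × ¬ ε ≈ 1#
  idempotent-of-family em pair {k} fam@(b , nonunit , comax) maximal = ε , ε²≈ε , ε≉0 , ε≉1
    where
    B = Π (b ∘ suc)
    B′ = Π λ (i : Fin k) → b (suc (suc i))
    b₀⊥B : Comaximal (b zero) B
    b₀⊥B = comaximal-Π (b ∘ suc) λ i → comax zero (suc i) λ ()
    u = proj₁ b₀⊥B
    v = proj₁ (proj₂ b₀⊥B)
    e = v * B

    -- An element 1 + Π b y is comaximal to every member, so if it were a nonunit it would enlarge
    -- the maximal family.
    Πb-J : Jacobson (Π b)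
    Πb-J y with em {IsUnit R (1# + Π b * y)}
    ... | yes unit = unit
    ... | no nonunit′ = contradiction (family-cons (1# + Π b * y) fam nonunit′ λ i → let r , eq = Π-factor b i in
            1# , - (r * y) , (begin
              1# * (1# + Π b * y) + - (r * y) * b i       ≈⟨ +-congʳ (*-congˡ (+-congˡ (*-congʳ eq))) ⟩
              1# * (1# + b i * r * y) + - (r * y) * b i   ≈⟨ solve 3 (λ b r y → :1 :* (:1 :+ b :* r :* y) :+ :- (r :* y) :* b := :1) refl (b i) r y ⟩
              1#                                          ∎)) maximal

    e²-e-J : Jacobson (e * e - e)
    e²-e-J = J-resp (begin
      Π b * (- (u * v))                                      ≈⟨ solve 4 (λ b B u v → b :* B :* :- (u :* v) := v :* B :* (v :* B :- (u :* b :+ v :* B))) refl (b zero) B u v ⟩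
      v * B * (v * B - (u * b zero + v * B))                 ≈⟨ *-congˡ (+-congˡ (-‿cong (proj₂ (proj₂ b₀⊥B)))) ⟩
      v * B * (v * B - 1#)                                   ≈⟨ solve 1 (λ e → e :* (e :- :1) := e :* e :- e) refl e ⟩
      e * e - e                                              ∎) (J-*ʳ (- (u * v)) Πb-J)

    -- x² - x has derivative 2x - 1, whose square is 1 + 4(x² - x).
    coeffs : List Carrier
    coeffs = 0# ∷ - 1# ∷ []
    value≈ : ∀ x → x * x - x ≈ eval R (monic R coeffs) x
    value≈ x = solve 1 (λ x → x :* x :- x := :0 :+ x :* (:- :1 :+ x :* (:1 :+ x :* :0))) refl x
    deriv-unit : IsUnit R (eval R (deriv R (monic R coeffs)) e)
    deriv-unit = unit-factor {y = D} (unit-resp (solve 1 (λ e →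
      let D = (:- :1 :+ :0) :+ e :* ((:1 :+ (:1 :+ :0)) :+ e :* :0) in
      :1 :+ (:1 :+ :1 :+ :1 :+ :1) :* (e :* e :- e) := D :* D) refl e)
      (J-unit+ unit-1 (J-*ˡ (1# + 1# + 1# + 1#) e²-e-J)))
      where D = eval R (deriv R (monic R coeffs)) e

    lifted = pair coeffs e (J-resp (value≈ e) e²-e-J) deriv-unit
    ε = proj₁ lifted
    ε²≈ε : ε * ε ≈ ε
    ε²≈ε = begin
      ε * ε              ≈⟨ solve 1 (λ ε → ε :* ε := (ε :* ε :- ε) :+ ε) refl ε ⟩
      ε * ε - ε + ε      ≈⟨ +-congʳ (trans (value≈ ε) (proj₁ (proj₂ lifted))) ⟩
      0# + ε             ≈⟨ +-identityˡ ε ⟩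
      ε                  ∎
    ε-e-J : Jacobson (ε - e)
    ε-e-J = proj₂ (proj₂ lifted)

    ε≉0 : ¬ ε ≈ 0#
    ε≉0 ε≈0 = nonunit zero (unit-factor {y = u} (unit-resp (begin
      1# + (ε - e)                       ≈⟨ +-cong (sym (proj₂ (proj₂ b₀⊥B))) (+-congʳ ε≈0) ⟩
      u * b zero + v * B + (0# - e)      ≈⟨ solve 3 (λ u b e → u :* b :+ e :+ (:0 :- e) := b :* u) refl u (b zero) e ⟩
      b zero * u                         ∎) (J-unit+ unit-1 ε-e-J)))

    ε≉1 : ¬ ε ≈ 1#
    ε≉1 ε≈1 = nonunit (suc zero) (unit-factor (unit-resp (begin
      1# + - (ε - e)             ≈⟨ +-congˡ (-‿cong (+-congʳ ε≈1)) ⟩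
      1# + - (1# - e)            ≈⟨ solve 3 (λ v b r → :1 :+ :- (:1 :- v :* (b :* r)) := b :* (r :* v)) refl v (b (suc zero)) (B′) ⟩
      b (suc zero) * (B′ * v)    ∎) (J-unit+ unit-1 (J-neg ε-e-J))))


-- Decomposition into local factors

IsLocal : {c ℓ : Level} → CommutativeRing c ℓ → Set (c ⊔ ℓ)
IsLocal {c} T = ¬ Lift c (1# ≈ 0#) × (∀ x y → ¬ IsUnit T x → ¬ IsUnit T y → ¬ IsUnit T (x + y))
  where open CommutativeRing T

module Decomposition {c ℓ : Level} (R : CommutativeRing c ℓ) where
  open CommutativeRing R hiding (zero)
  open IntegerSolver R
  open import Relation.Binary.Reasoning.Setoid setoid
  open Comaximality using (Comaximal; Family; family-cons)

  private
    -- Identities that hold only modulo ε² - ε are reduced to polynomial identities by naming the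
    -- multiple `k` of ε² - ε, so that the solver applies.
    modulo-idempotent : ∀ {ε L} k {L′} → ε * ε ≈ ε → L ≈ L′ + k * (ε * ε - ε) → L ≈ L′
    modulo-idempotent {ε} {L} k {L′} ε²≈ε eq = begin
      L                          ≈⟨ eq ⟩
      L′ + k * (ε * ε - ε)       ≈⟨ +-congˡ (trans (*-congˡ (trans (+-congʳ ε²≈ε) (-‿inverseʳ ε))) (zeroʳ k)) ⟩
      L′ + 0#                    ≈⟨ +-identityʳ L′ ⟩
      L′                         ∎

  -- Extend the members of the family by 1 on the complementary factor; ε itself is comaximal to all of them.
  family-of-factor : ∀ {ε} → ε * ε ≈ ε → ¬ ε ≈ 1# → ∀ {n} → Family (localise R ε) n → Family R (suc n)
  family-of-factor {ε} ε²≈ε ε≉1 {n} (b , nonunit , comax) = family-cons R ε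
    (b̂ , b̂-nonunit , b̂-comaximal) ε-nonunit ε-comaximal
    where
    b̂ : Fin n → Carrier
    b̂ j = ε * b j + (1# - ε)
    b̂-nonunit : ∀ j → ¬ IsUnit R (b̂ j)
    b̂-nonunit j (s , eq) = nonunit j (s , (begin
      ε * (b j * s)        ≈⟨ modulo-idempotent (s - b j * s) ε²≈ε
                               (solve 3 (λ ε b s → ε :* (b :* s) := ε :* ((ε :* b :+ (:1 :- ε)) :* s) :+ (s :- b :* s) :* (ε :* ε :- ε)) refl ε (b j) s) ⟩
      ε * (b̂ j * s)        ≈⟨ *-congˡ eq ⟩
      ε * 1#               ∎))
    b̂-comaximal : ∀ i j → i ≢ j → Comaximal R (b̂ i) (b̂ j)
    b̂-comaximal i j i≢j = let u , v , eq = comax i j i≢j in ε * u + (1# - ε) , ε * v , (begin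
      (ε * u + (1# - ε)) * b̂ i + ε * v * b̂ j
        ≈⟨ modulo-idempotent (u * b i - u - b i + 1# + (v * b j - v)) ε²≈ε
             (solve 5 (λ ε u v b b′ → (ε :* u :+ (:1 :- ε)) :* (ε :* b :+ (:1 :- ε)) :+ ε :* v :* (ε :* b′ :+ (:1 :- ε))
               := ε :* (u :* b :+ v :* b′) :+ (:1 :- ε) :+ (u :* b :- u :- b :+ :1 :+ (v :* b′ :- v)) :* (ε :* ε :- ε)) refl ε u v (b i) (b j)) ⟩
      ε * (u * b i + v * b j) + (1# - ε)
        ≈⟨ +-congʳ eq ⟩
      ε * 1# + (1# - ε)
        ≈⟨ solve 1 (λ ε → ε :* :1 :+ (:1 :- ε) := :1) refl ε ⟩
      1# ∎)
    ε-nonunit : ¬ IsUnit R ε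
    ε-nonunit (s , eq) = ε≉1 (begin
      ε              ≈⟨ *-identityʳ ε ⟨
      ε * 1#         ≈⟨ *-congˡ eq ⟨
      ε * (ε * s)    ≈⟨ modulo-idempotent s ε²≈ε (solve 2 (λ ε s → ε :* (ε :* s) := ε :* s :+ s :* (ε :* ε :- ε)) refl ε s) ⟩
      ε * s          ≈⟨ eq ⟩
      1#             ∎)
    ε-comaximal : ∀ j → Comaximal R ε (b̂ j)
    ε-comaximal j = 1# , 1# - ε , modulo-idempotent (1# - b j) ε²≈ε
      (solve 2 (λ ε b → :1 :* ε :+ (:1 :- ε) :* (ε :* b :+ (:1 :- ε)) := :1 :+ (:1 :- b) :* (ε :* ε :- ε)) refl ε (b j))

  family-localise-* : ∀ {e ε n} → Family (localise R (e * ε)) n → Family (localise (localise R e) ε) n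
  family-localise-* {e} {ε} (b , nonunit , comax) = b
    , (λ i (y , eq) → nonunit i (y , trans (*-assoc e ε _) (trans eq (sym (*-assoc e ε _)))))
    , λ i j i≢j → let u , v , eq = comax i j i≢j in u , v , trans (sym (*-assoc e ε _)) (trans eq (*-assoc e ε _))

  Orthogonal : Carrier → Carrier → Set ℓ
  Orthogonal x y = x * y ≈ 0#

  sum : List Carrier → Carrier
  sum = foldr _+_ 0#

  sum-++ : ∀ xs ys → sum (xs List.++ ys) ≈ sum xs + sum ys
  sum-++ [] ys = sym (+-identityˡ _)
  sum-++ (x ∷ xs) ys = trans (+-congˡ (sum-++ xs ys)) (sym (+-assoc x _ _))

  -- The field `below` keeps the idempotents inside eR, which makes those of two complementary
  -- factors orthogonal in `combine`.
  record LocalDecomposition (e : Carrier) : Set (c ⊔ ℓ) where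
    field
      idempotents : List Carrier
      idempotent : All (λ ε → ε * ε ≈ ε) idempotents
      below : All (λ ε → e * ε ≈ ε) idempotents
      orthogonal : AllPairs Orthogonal idempotents
      total : sum idempotents ≈ e
      local : All (λ ε → IsLocal (localise R ε)) idempotents

  open LocalDecomposition

  module _ {e ε : Carrier} (e²≈e : e * e ≈ e) where
    idempotent-* : e * (ε * ε) ≈ e * ε → e * ε * (e * ε) ≈ e * ε
    idempotent-* h = begin
      e * ε * (e * ε)      ≈⟨ solve 2 (λ e ε → e :* ε :* (e :* ε) := e :* e :* (ε :* ε)) refl e ε ⟩
      e * e * (ε * ε)      ≈⟨ *-congʳ e²≈e ⟩
      e * (ε * ε)          ≈⟨ h ⟩
      e * ε                ∎

    below-* : ∀ {x} → e * ε * x ≈ x → e * x ≈ x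
    below-* {x} h = begin
      e * x                ≈⟨ *-congˡ h ⟨
      e * (e * ε * x)      ≈⟨ solve 3 (λ e ε x → e :* (e :* ε :* x) := e :* e :* (ε :* x)) refl e ε x ⟩
      e * e * (ε * x)      ≈⟨ *-congʳ e²≈e ⟩
      e * (ε * x)          ≈⟨ *-assoc e ε x ⟨
      e * ε * x            ≈⟨ h ⟩
      x                    ∎

  complement-idempotent : ∀ {e ε} → e * (ε * ε) ≈ e * ε → e * ((1# - ε) * (1# - ε)) ≈ e * (1# - ε)
  complement-idempotent {e} {ε} h = begin
    e * ((1# - ε) * (1# - ε))                      ≈⟨ solve 2 (λ e ε → e :* ((:1 :- ε) :* (:1 :- ε)) := e :* (:1 :- ε) :+ (e :* (ε :* ε) :- e :* ε)) refl e ε ⟩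
    e * (1# - ε) + (e * (ε * ε) - e * ε)           ≈⟨ +-congˡ (trans (+-congʳ h) (-‿inverseʳ _)) ⟩
    e * (1# - ε) + 0#                              ≈⟨ +-identityʳ _ ⟩
    e * (1# - ε)                                   ∎

  combine : ∀ {e ε} → e * e ≈ e → e * (ε * ε) ≈ e * ε →
    LocalDecomposition (e * ε) → LocalDecomposition (e * (1# - ε)) → LocalDecomposition e
  combine {e} {ε} e²≈e h D₁ D₂ = record
    { idempotents = idempotents D₁ List.++ idempotents D₂
    ; idempotent = All.++⁺ (idempotent D₁) (idempotent D₂)
    ; below = All.++⁺ (All.map (below-* e²≈e) (below D₁)) (All.map (below-* e²≈e) (below D₂))
    ; orthogonal = AllPairs.++⁺ (orthogonal D₁) (orthogonal D₂)
        (All.map (λ bx → All.map (λ by → cross bx by) (below D₂)) (below D₁))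
    ; total = trans (sum-++ (idempotents D₁) (idempotents D₂)) (trans (+-cong (total D₁) (total D₂))
        (solve 2 (λ e ε → e :* ε :+ e :* (:1 :- ε) := e) refl e ε))
    ; local = All.++⁺ (local D₁) (local D₂) }
    where
    cross : ∀ {x y} → e * ε * x ≈ x → e * (1# - ε) * y ≈ y → x * y ≈ 0#
    cross {x} {y} hx hy = begin
      x * y                                            ≈⟨ *-cong hx hy ⟨
      e * ε * x * (e * (1# - ε) * y)                   ≈⟨ solve 4 (λ e ε x y → e :* ε :* x :* (e :* (:1 :- ε) :* y) := (e :* ε :- e :* (ε :* ε)) :* (e :* x :* y)) refl e ε x y ⟩
      (e * ε - e * (ε * ε)) * (e * x * y)              ≈⟨ *-congʳ (trans (+-congˡ (-‿cong h)) (-‿inverseʳ _)) ⟩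
      0# * (e * x * y)                                 ≈⟨ zeroˡ _ ⟩
      0#                                               ∎

module _ {c ℓ : Level} (em : ExcludedMiddle (c ⊔ ℓ)) (R : CommutativeRing c ℓ) {p : ℕ}
  (p-prime : Prime p) (char : IsFpAlgebra R p) (nip : NIP R) where
  open CommutativeRing R hiding (zero)
  open IntegerSolver R
  open Decomposition R
  open Comaximality using (Comaximal; Family; family-0; family-cons; family-drop; maximal-family; idempotent-of-family)

  henselian-factor : ∀ e → IsHenselianPair (localise R e)
  henselian-factor e = NIPHensel.henselian-pair em (localise R e) p-prime (localise-char R e {p} char) (localise-NIP R e nip)

  -- Two nonunits with a unit sum are comaximal, so they form a family of size 2. Some family of
  -- size at least 2 is then maximal, and it yields an idempotent.
  splitting-idempotent : ∀ {N} e x y →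
    ¬ IsUnit (localise R e) x → ¬ IsUnit (localise R e) y → IsUnit (localise R e) (x + y) → ¬ Family (localise R e) N →
    Σ Carrier λ ε → e * (ε * ε) ≈ e * ε × ¬ e * ε ≈ e * 0# × ¬ e * ε ≈ e * 1#
  splitting-idempotent {N} e x y ¬ux ¬uy (w , eq) ¬fam =
    let j , fam , maximal = maximal-family T em N {2} two λ f → ¬fam (subst-drop f) in
    idempotent-of-family T em (henselian-factor e) (≡.subst (Family T) (ℕ.+-comm j 2) fam)
      (λ f → maximal (≡.subst (λ k → Family T (suc k)) (≡.sym (ℕ.+-comm j 2)) f))
    where
    T = localise R e
    module T = CommutativeRing T
    subst-drop : Family T (N ℕ.+ 2) → Family T N
    subst-drop f = family-drop T 2 (≡.subst (Family T) (ℕ.+-comm N 2) f)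
    x⊥y : Comaximal T x y
    x⊥y = w , w , T.trans (T.trans (T.sym (T.distribˡ w x y)) (T.*-comm w (x T.+ y))) eq
    two : Family T 2
    two = family-cons T x (family-cons T y (family-0 T) ¬uy λ ()) ¬ux λ { zero → x⊥y }

  -- Induction on a bound for comaximal families. A family of N members in a proper factor gives N +
  -- 1 members in the ring being split, so both factors satisfy the smaller bound.
  decompose : ∀ N e → e * e ≈ e → ¬ Family (localise R e) N → LocalDecomposition e
  decompose zero e _ ¬fam = contradiction (family-0 (localise R e)) ¬fam
  decompose (suc N) e e²≈e ¬fam with em {Lift c (e ≈ 0#)} | em {IsLocal (localise R e)}
  -- The zero ring is the empty product.
  ... | yes (lift e≈0) | _ = record
    { idempotents = [] ; idempotent = [] ; below = [] ; orthogonal = [] ; total = sym e≈0 ; local = [] }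
  ... | no _ | yes local-e = record
    { idempotents = e ∷ [] ; idempotent = e²≈e ∷ [] ; below = e²≈e ∷ [] ; orthogonal = [] ∷ []
    ; total = +-identityʳ e ; local = local-e ∷ [] }
  ... | no e≉0 | no ¬local with em {Σ Carrier λ x → Σ Carrier λ y →
      ¬ IsUnit (localise R e) x × ¬ IsUnit (localise R e) y × IsUnit (localise R e) (x + y)}
  ...   | no none = contradiction
          ((λ (lift e1≈e0) → e≉0 (lift (trans (sym (*-identityʳ e)) (trans e1≈e0 (zeroʳ e)))))
          , λ x y ¬ux ¬uy uxy → none (x , y , ¬ux , ¬uy , uxy)) ¬local
  ...   | yes (x , y , ¬ux , ¬uy , uxy) =
    let ε , eε² , ε≉0 , ε≉1 = splitting-idempotent {suc N} e x y ¬ux ¬uy uxy ¬fam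
        eδ² = complement-idempotent {e} {ε} eε²
    in combine e²≈e eε²
      (decompose N (e * ε) (idempotent-* e²≈e eε²)
        λ f → ¬fam (Decomposition.family-of-factor (localise R e) eε² ε≉1 (family-localise-* f)))
      (decompose N (e * (1# - ε)) (idempotent-* e²≈e eδ²)
        λ f → ¬fam (Decomposition.family-of-factor (localise R e) eδ²
          (λ δ≈1 → ε≉0 (begin
            e * ε                       ≈⟨ solve 2 (λ e ε → e :* ε := e :* :1 :- e :* (:1 :- ε)) refl e ε ⟩
            e * 1# - e * (1# - ε)       ≈⟨ +-congˡ (-‿cong δ≈1) ⟩
            e * 1# - e * 1#             ≈⟨ -‿inverseʳ _ ⟩
            0#                          ≈⟨ zeroʳ e ⟨
            e * 0#                      ∎))
          (family-localise-* f)))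
    where open import Relation.Binary.Reasoning.Setoid setoid

  localDecomposition : LocalDecomposition 1#
  localDecomposition =
    let N , ¬fam = Comaximality.family-bound (localise R 1#) em (localise-NIP R 1# nip) in
    decompose N 1# (*-identityˡ 1#) ¬fam

-- Henselian local rings from Henselian pairs

module LocalRing {c ℓ : Level} (em : ExcludedMiddle (c ⊔ ℓ)) (T : CommutativeRing c ℓ) where
  open CommutativeRing T hiding (zero)
  open IntegerSolver T
  open RingFacts T

  -- In a local ring the nonunits are the only maximal ideal and coincide with the Jacobson radical,
  -- so the root supplied by the Henselian pair is the one required.
  isHenselianLocal : IsLocal T → IsHenselianPair T → IsHenselianLocal T
  isHenselianLocal (1≉0 , nonunit-+) pair = record
    { 𝔪 = 𝔪
    ; 𝔪-maximal = 𝔪-ideal , 1∉𝔪 , maximal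
    ; 𝔪-unique = λ M M-maximal x → M⊆𝔪 M M-maximal x , 𝔪⊆M M M-maximal x
    ; hensel = λ as b fb∈𝔪 f′b∉𝔪 →
        let b′ , root , b′-b-J = pair as b (𝔪⊆Jacobson fb∈𝔪) (∉𝔪⇒unit f′b∉𝔪) in b′ , root , Jacobson⊆𝔪 b′-b-J }
    where
    𝔪 : Carrier → Set (c ⊔ ℓ)
    𝔪 x = ¬ IsUnit T x
    1∉𝔪 : ¬ 𝔪 1#
    1∉𝔪 ¬u1 = ¬u1 unit-1
    ∉𝔪⇒unit : ∀ {x} → ¬ 𝔪 x → IsUnit T x
    ∉𝔪⇒unit {x} x∉𝔪 with em {IsUnit T x}
    ... | yes ux = ux
    ... | no ¬ux = contradiction ¬ux x∉𝔪
    𝔪-* : ∀ r {x} → 𝔪 x → 𝔪 (r * x)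
    𝔪-* r ¬ux urx = ¬ux (unit-factor (unit-resp (*-comm r _) urx))
    𝔪-ideal : IsIdeal T 𝔪
    𝔪-ideal = record
      { resp = λ x≈y ¬ux uy → ¬ux (unit-resp (sym x≈y) uy)
      ; zero∈ = λ (y , 0y≈1) → 1≉0 (lift (trans (sym 0y≈1) (zeroˡ y)))
      ; +-closed = nonunit-+ _ _
      ; *-closed = 𝔪-* }
    proper⇒⊆𝔪 : ∀ {I : Carrier → Set (c ⊔ ℓ)} → IsIdeal T I → ¬ I 1# → ∀ x → I x → 𝔪 x
    proper⇒⊆𝔪 ideal ¬I1 x Ix (y , xy≈1) = ¬I1 (resp (trans (*-comm y x) xy≈1) (*-closed y Ix))
      where open IsIdeal ideal
    maximal : ∀ (I : Carrier → Set (c ⊔ ℓ)) → IsIdeal T I → (∀ x → 𝔪 x → I x) → (∀ x → I x → 𝔪 x) ⊎ I 1#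
    maximal I ideal _ with em {I 1#}
    ... | yes I1 = inj₂ I1
    ... | no ¬I1 = inj₁ (proper⇒⊆𝔪 ideal ¬I1)
    M⊆𝔪 : ∀ M → IsMaximalIdeal T M → ∀ x → M x → 𝔪 x
    M⊆𝔪 M (ideal , ¬M1 , _) = proper⇒⊆𝔪 ideal ¬M1
    𝔪⊆M : ∀ M → IsMaximalIdeal T M → ∀ x → 𝔪 x → M x
    𝔪⊆M M M-max@(_ , _ , maximal-M) x 𝔪x with maximal-M 𝔪 𝔪-ideal (M⊆𝔪 M M-max)
    ... | inj₁ ⊆M = ⊆M x 𝔪x
    ... | inj₂ 𝔪1 = contradiction 𝔪1 1∉𝔪
    𝔪⊆Jacobson : ∀ {x} → 𝔪 x → Jacobson x
    𝔪⊆Jacobson {x} ¬ux y = ∉𝔪⇒unit λ ¬u → nonunit-+ _ _ ¬u (𝔪-* (- y) ¬ux)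
      (unit-resp (solve 2 (λ x y → :1 := :1 :+ x :* y :+ :- y :* x) refl x y) unit-1)
    Jacobson⊆𝔪 : ∀ {x} → Jacobson x → 𝔪 x
    Jacobson⊆𝔪 {x} jx (y , xy≈1) = IsIdeal.zero∈ 𝔪-ideal (unit-resp
      (trans (solve 2 (λ x y → :1 :+ x :* :- y := :1 :- x :* y) refl x y) (trans (+-congˡ (-‿cong xy≈1)) (-‿inverseʳ 1#)))
      (jx (- y)))

-- R as the product of its factors

module ProductOfFactors {c ℓ : Level} (R : CommutativeRing c ℓ) where
  open CommutativeRing R hiding (zero)
  open IntegerSolver R
  open Decomposition R
  open import Relation.Binary.Reasoning.Setoid setoid

  combination : ∀ es → (Fin (length es) → Carrier) → Carrier
  combination [] u = 0#
  combination (e ∷ es) u = e * u zero + combination es (u ∘ suc)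

  combination-cong : ∀ es {u v} → (∀ i → lookup es i * u i ≈ lookup es i * v i) → combination es u ≈ combination es v
  combination-cong [] h = refl
  combination-cong (e ∷ es) h = +-cong (h zero) (combination-cong es (h ∘ suc))

  combination-const : ∀ es x → combination es (λ _ → x) ≈ sum es * x
  combination-const [] x = sym (zeroˡ x)
  combination-const (e ∷ es) x = trans (+-congˡ (combination-const es x)) (sym (distribʳ x e _))

  combination-orthogonal : ∀ {e es} u → All (Orthogonal e) es → e * combination es u ≈ 0#
  combination-orthogonal u [] = zeroʳ _
  combination-orthogonal {e} {f ∷ es} u (ef≈0 ∷ orth) = begin
    e * (f * u zero + combination es (u ∘ suc))       ≈⟨ solve 4 (λ e f x y → e :* (f :* x :+ y) := e :* f :* x :+ e :* y) refl e f (u zero) (combination es (u ∘ suc)) ⟩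
    e * f * u zero + e * combination es (u ∘ suc)     ≈⟨ +-cong (trans (*-congʳ ef≈0) (zeroˡ _)) (combination-orthogonal (u ∘ suc) orth) ⟩
    0# + 0#                                           ≈⟨ +-identityˡ 0# ⟩
    0#                                                ∎

  combination-component : ∀ {es} u → All (λ ε → ε * ε ≈ ε) es → AllPairs Orthogonal es →
    ∀ i → lookup es i * combination es u ≈ lookup es i * u i
  combination-component {e ∷ es} u (e²≈e ∷ _) (orth ∷ _) zero = begin
    e * (e * u zero + combination es (u ∘ suc))           ≈⟨ solve 3 (λ e x y → e :* (e :* x :+ y) := e :* e :* x :+ e :* y) refl e (u zero) (combination es (u ∘ suc)) ⟩
    e * e * u zero + e * combination es (u ∘ suc)         ≈⟨ +-cong (*-congʳ e²≈e) (combination-orthogonal (u ∘ suc) orth) ⟩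
    e * u zero + 0#                                       ≈⟨ +-identityʳ _ ⟩
    e * u zero                                            ∎
  combination-component {e ∷ es} u (_ ∷ idem) (orth ∷ orths) (suc i) = begin
    f * (e * u zero + combination es (u ∘ suc))           ≈⟨ solve 4 (λ f e x y → f :* (e :* x :+ y) := e :* f :* x :+ f :* y) refl f e (u zero) (combination es (u ∘ suc)) ⟩
    e * f * u zero + f * combination es (u ∘ suc)         ≈⟨ +-cong (trans (*-congʳ (All.lookup orth (∈-lookup i))) (zeroˡ _)) (combination-component (u ∘ suc) idem orths i) ⟩
    0# + f * u (suc i)                                    ≈⟨ +-identityˡ _ ⟩
    f * u (suc i)                                         ∎
    where f = lookup es i

  -- All factors share the carrier of R, so the diagonal is a homomorphism by computation. Its
  -- inverse weights the components by the idempotents: orthogonality gives one composite and total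
  -- sum 1 the other.
  isoToProduct : (D : LocalDecomposition 1#) → let es = LocalDecomposition.idempotents D in
    IsoToProduct R (length es) (λ i → localise R (lookup es i))
  isoToProduct D = record
    { to = λ x _ → x
    ; from = combination es
    ; to-cong = λ x≈y i → *-congˡ x≈y
    ; from-cong = combination-cong es
    ; to-from = λ u i → combination-component u idempotent orthogonal i
    ; from-to = λ x → trans (combination-const es x) (trans (*-congʳ total) (*-identityˡ x))
    ; to-+ = λ _ _ _ → refl
    ; to-* = λ _ _ _ → refl
    ; to-1 = λ _ → refl }
    where
    open LocalDecomposition D
    es = idempotents

theorem3p14 : ∀ {c ℓ} → ExcludedMiddle (c ⊔ ℓ) →
    (p : ℕ) → Prime p → (R : CommutativeRing c ℓ) →
    IsFpAlgebra R p → NIP R →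
    Σ ℕ λ n → Σ (Fin n → CommutativeRing c ℓ) λ S →
    ((i : Fin n) → IsHenselianLocal (S i)) × IsoToProduct R n S
theorem3p14 em p p-prime R char nip = length es , (λ i → localise R (lookup es i)) ,
  (λ i → LocalRing.isHenselianLocal em (localise R (lookup es i))
    (All.lookup (LocalDecomposition.local D) (∈-lookup i))
    (henselian-factor em R p-prime char nip (lookup es i))) ,
  ProductOfFactors.isoToProduct R D
  where
  open Decomposition R using (module LocalDecomposition)
  D = localDecomposition em R p-prime char nip
  es = LocalDecomposition.idempotents D
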